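{- For every $\delta>0$, there is $\rho>0$ such that the following holds for all sufficiently large $n$ (depending on $\delta$ and $\rho$). If $G$ is an $n$-vertex $C_8$-free graph whose number $\mathrm{N}(C_6,G)$ of copies of $C_6$ satisfies \[ \mathrm{N}(C_6,G)\ge R(n):=6\binom{n-3}{3}+12(n-5), \] then there is a triple $\{a,b,c\}$ of distinct vertices of $G$ with \[ |N(a)\cap N(b)\cap N(c)|\ge(1-\delta)n. \]
   Context: All graphs are finite, simple and undirected; $N(v)$ is the (open) neighborhood of $v$ in $G$. A graph is $C_8$-free if it has no (not necessarily induced) subgraph isomorphic to the 8-cycle. $\mathrm{N}(C_6,G)$ is the number of subgraphs of $G$ (not necessarily induced) isomorphic to the 6-cycle $C_6$. The number $\rho$ is an auxiliary parameter that does not occur in the hypothesis or conclusion on $G$; it may only influence how large $n$ must be. -}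

module Defs where

open import Data.Fin.Base using (Fin; toℕ; finToFun; funToFin)
open import Data.Fin.Properties as Fin using (toℕ<n; finToFun-funToFin)
open import Data.Fin.Subset using (Subset; inside; outside; _∈_; _∉_; _⊆_)
open import Data.Fin.Subset.Properties using (_∈?_; _⊆?_)
open import Data.List.Base using (List; []; _∷_; length; filter; cartesianProduct; cartesianProductWith)
open import Data.Nat.Base using (ℕ; zero; suc; _+_; _*_; _∸_; NonTrivial; nonTrivial⇒nonZero; nonTrivial⇒n>1)
open import Data.Nat.Combinatorics using (_C_)
open import Data.Nat.DivMod using (_%_; m<n⇒m%n≡m; n%n≡0)
open import Data.Nat.Properties as ℕ using (m≤n⇒m<n∨m≡n; 1+n≢n)
open import Data.Product.Base using (∃; _×_; _,_; proj₁; proj₂)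
open import Data.Sum.Base using (_⊎_; inj₁; inj₂; swap; [_,_]′)
open import Data.Vec.Base using (Vec; []; _∷_; lookup; tabulate)
open import Data.Vec.Properties using (lookup∘tabulate; lookup⇒[]=; []=⇒lookup)
open import Function.Definitions using (Injective)
open import Relation.Binary.PropositionalEquality using (_≡_; _≗_; refl; sym; trans; cong; subst; subst₂)
open import Relation.Nullary using (¬_; Dec; yes; no; does)
open import Relation.Nullary.Decidable using (map′; dec-true; _×-dec_; _⊎-dec_; _→-dec_)
open import Relation.Unary using (Decidable)

private
  variable
    k n : ℕ

-- A simple graph on the vertex set Fin n, given by its open neighbourhoods.
record Graph (n : ℕ) : Set where
  field
    N        : Fin n → Subset n
    N-sym    : ∀ {u v} → v ∈ N u → u ∈ N v
    N-irrefl : ∀ {v} → v ∉ N v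

open Graph public using (N)

module _ {n : ℕ} (P : Fin n → Set) (P? : Decidable P) where

  toSubset : Subset n
  toSubset = tabulate (λ i → does (P? i))

  ∈-toSubset⁺ : ∀ {i} → P i → i ∈ toSubset
  ∈-toSubset⁺ {i} p =
    lookup⇒[]= i _ (trans (lookup∘tabulate _ i) (dec-true (P? i) p))

  ∈-toSubset⁻ : ∀ {i} → i ∈ toSubset → P i
  ∈-toSubset⁻ {i} i∈ with P? i | trans (sym (lookup∘tabulate (λ j → does (P? j)) i)) ([]=⇒lookup i∈)
  ... | yes p | _  = p
  ... | no _  | ()

module _ (k : ℕ) .{{_ : NonTrivial k}} where
  private
    instance
      k≢0 = nonTrivial⇒nonZero k

  Next : Fin k → Fin k → Set
  Next i j = toℕ j ≡ suc (toℕ i) % k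

  CycleAdj : Fin k → Fin k → Set
  CycleAdj i j = Next i j ⊎ Next j i

  cycleAdj? : ∀ i j → Dec (CycleAdj i j)
  cycleAdj? i j = (toℕ j ℕ.≟ suc (toℕ i) % k) ⊎-dec (toℕ i ℕ.≟ suc (toℕ j) % k)

  private
    next-irrefl : ∀ i → ¬ Next i i
    next-irrefl i eq with m≤n⇒m<n∨m≡n (toℕ<n i)
    ... | inj₁ 1+i<k = 1+n≢n (sym (trans eq (m<n⇒m%n≡m 1+i<k)))
    ... | inj₂ 1+i≡k = ℕ.<-irrefl (trans (cong suc (sym i≡0)) 1+i≡k) (nonTrivial⇒n>1 k)
      where
      i≡0 : toℕ i ≡ 0
      i≡0 = trans eq (trans (cong (_% k) 1+i≡k) (n%n≡0 k))

  -- The cycle 0, 1, …, k-1, 0; this is the k-cycle when k ≥ 3.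
  Cycle : Graph k
  Cycle = record
    { N        = λ i → toSubset (CycleAdj i) (cycleAdj? i)
    ; N-sym    = λ {i} {j} j∈ →
        ∈-toSubset⁺ (CycleAdj j) (cycleAdj? j)
          (swap (∈-toSubset⁻ (CycleAdj i) (cycleAdj? i) j∈))
    ; N-irrefl = λ {i} i∈ →
        [ next-irrefl i , next-irrefl i ]′ (∈-toSubset⁻ (CycleAdj i) (cycleAdj? i) i∈)
    }

-- A candidate subgraph: a vertex set together with the list of
-- neighbourhoods.  This first-order encoding is canonical, so distinct
-- candidates satisfying IsSubgraph are distinct subgraphs.
PreSubgraph : ℕ → Set
PreSubgraph n = Subset n × Vec (Subset n) n

V : PreSubgraph n → Subset n
V = proj₁

Nₛ : PreSubgraph n → Fin n → Subset n
Nₛ H = lookup (proj₂ H)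

-- (V , Nₛ) is a graph whose edges are edges of G.  Irreflexivity is
-- inherited from G.
IsSubgraph : Graph n → PreSubgraph n → Set
IsSubgraph G H =
    (∀ u → Nₛ H u ⊆ N G u)
  × (∀ u v → v ∈ Nₛ H u → u ∈ Nₛ H v)
  × (∀ u v → v ∈ Nₛ H u → u ∈ V H × v ∈ V H)

-- f is an isomorphism from F onto (V , Nₛ).
IsIso : Graph k → PreSubgraph n → (Fin k → Fin n) → Set
IsIso F H f =
    Injective _≡_ _≡_ f
  × (∀ i → f i ∈ V H)
  × (∀ v → v ∈ V H → ∃ λ i → f i ≡ v)
  × (∀ i j → (j ∈ N F i → f j ∈ Nₛ H (f i)) × (f j ∈ Nₛ H (f i) → j ∈ N F i))

-- H is a copy of F in G: a (not necessarily induced) subgraph of G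
-- isomorphic to F.
IsCopy : Graph k → Graph n → PreSubgraph n → Set
IsCopy F G H = IsSubgraph G H × ∃ (IsIso F H)

Free : Graph k → Graph n → Set
Free F G = ¬ ∃ (IsCopy F G)

isSubgraph? : (G : Graph n) → Decidable (IsSubgraph G)
isSubgraph? G H =
  Fin.all? (λ u → Nₛ H u ⊆? N G u)
  ×-dec Fin.all? (λ u → Fin.all? λ v → (v ∈? Nₛ H u) →-dec (u ∈? Nₛ H v))
  ×-dec Fin.all? (λ u → Fin.all? λ v →
    (v ∈? Nₛ H u) →-dec ((u ∈? V H) ×-dec (v ∈? V H)))

injective? : (f : Fin k → Fin n) → Dec (Injective _≡_ _≡_ f)
injective? f = map′ (λ inj {i} {j} → inj i j) (λ inj i j → inj {i} {j})
  (Fin.all? λ i → Fin.all? λ j → (f i Fin.≟ f j) →-dec (i Fin.≟ j))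

isIso? : (F : Graph k) (H : PreSubgraph n) → Decidable (IsIso F H)
isIso? F H f =
  injective? f
  ×-dec Fin.all? (λ i → f i ∈? V H)
  ×-dec Fin.all? (λ v → (v ∈? V H) →-dec Fin.any? λ i → f i Fin.≟ v)
  ×-dec Fin.all? (λ i → Fin.all? λ j →
    ((j ∈? N F i) →-dec (f j ∈? Nₛ H (f i)))
    ×-dec ((f j ∈? Nₛ H (f i)) →-dec (j ∈? N F i)))

isIso-resp-≗ : ∀ (F : Graph k) (H : PreSubgraph n) {f g} → f ≗ g → IsIso F H f → IsIso F H g
isIso-resp-≗ F H f≗g (inj , into , onto , adj) =
    (λ {i} {j} eq → inj (trans (f≗g i) (trans eq (sym (f≗g j)))))
  , (λ i → subst (_∈ V H) (f≗g i) (into i))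
  , (λ v v∈ → let i , eq = onto v v∈ in i , trans (sym (f≗g i)) eq)
  , (λ i j →
        (λ j∈ → subst₂ (λ x y → x ∈ Nₛ H y) (f≗g j) (f≗g i) (proj₁ (adj i j) j∈))
      , (λ g∈ → proj₂ (adj i j)
          (subst₂ (λ x y → x ∈ Nₛ H y) (sym (f≗g j)) (sym (f≗g i)) g∈)))

∃iso? : (F : Graph k) (H : PreSubgraph n) → Dec (∃ (IsIso F H))
∃iso? {k} {n} F H = map′
  (λ (c , iso) → finToFun c , iso)
  (λ (f , iso) → funToFin f
               , isIso-resp-≗ F H (λ i → sym (finToFun-funToFin f i)) iso)
  (Fin.any? λ c → isIso? F H (finToFun {n} {k} c))

isCopy? : (F : Graph k) (G : Graph n) → Decidable (IsCopy F G)
isCopy? F G H = isSubgraph? G H ×-dec ∃iso? F H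

-- All vectors with entries from a list; repetition-free if the list is.
vectors : {A : Set} → List A → ∀ m → List (Vec A m)
vectors xs zero    = [] ∷ []
vectors xs (suc m) = cartesianProductWith _∷_ xs (vectors xs m)

subsets : ∀ n → List (Subset n)
subsets n = vectors (outside ∷ inside ∷ []) n

preSubgraphs : ∀ n → List (PreSubgraph n)
preSubgraphs n = cartesianProduct (subsets n) (vectors (subsets n) n)

-- The number of subgraphs of G isomorphic to F.
#copies : Graph k → Graph n → ℕ
#copies F G = length (filter (isCopy? F G) (preSubgraphs _))

-- Subtraction is truncated, which only matters for n < 5.
R : ℕ → ℕ
R n = 6 * ((n ∸ 3) C 3) + 12 * (n ∸ 5)

{-# OPTIONS --safe #-}
module Submission where

-- Call a pair of vertices fat if its codegree exceeds 8; then a common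
-- neighbour can be found outside any other seven vertices of an 8-cycle
-- under construction.  If two adjacent vertices v, w of a 6-cycle are both
-- midpoints of fat pairs (their neighbours on the cycle), rerouting gives
-- an 8-cycle.  Hence in every 6-cycle either two opposite vertices are
-- midpoints of thin pairs, or three alternate vertices are pairwise fat.
--
-- Cycles of the first kind are few.  A C₈-free graph has O(n) edges at
-- N(v), and O(n) edges at the vertices at distance two from v, for every
-- v (a denser bipartite graph contains long paths, which close up through
-- v).  The first bound gives Σ d(v)² = O(n²), so Σ d(v) = o(n²), and the
-- second then bounds the number of these cycles by O(n) Σ d(v) = o(n³).
--
-- In a cycle x a y b z c of the second kind the ordered pair (a, b)
-- determines the fat triangle {x, y, z}, since two such triangles contain
-- disjoint fat pairs or form a fat 4-cycle.  Choosing the labelling so that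
-- {x, z} has codegree below (1 - ε)n if some pair does, there are at most
-- n² (1 - ε)n such cycles.  As R(n) = n³ - O(n²), some fat triangle has all
-- codegrees at least (1 - ε)n, hence (1 - 2ε)n common neighbours.

open import Defs
open import Data.Fin.Base as Fin using (Fin; zero; suc)
open import Data.Fin.Patterns using (0F; 1F; 2F; 3F; 4F; 5F; 6F; 7F)
open import Data.Fin.Properties as Fin using (any?; injective⇒≤)
open import Data.Fin.Subset using (Subset; inside; outside; _∈_; _⊆_; _∩_; ∣_∣; ⊤)
open import Data.Fin.Subset.Properties using (_∈?_; x∈p∩q⁺; ⊆-antisym; ∈⊤)
open import Data.Integer.Base as ℤ using (+_; -[1+_])
import Data.Integer.Properties as ℤ
import Data.Integer.Tactic.RingSolver as ℤ-solver
open import Data.List.Base as List using (List; []; _∷_; _++_; length; filter; map; concatMap; allFin)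
open import Data.List.Membership.DecPropositional using () renaming (_∈?_ to member?)
open import Data.List.Membership.Propositional using (find; lose) renaming (_∈_ to _∈ₗ_; _∉_ to _∉ₗ_)
open import Data.List.Membership.Propositional.Properties using
  (∈-filter⁺; ∈-filter⁻; ∈-allFin; ∈-lookup; ∈-map⁺; ∈-++⁺ˡ; ∈-++⁺ʳ; ∈-concatMap⁺)
import Data.List.Membership.Setoid.Properties as Membershipₛ
open import Data.List.Properties using (length-++; length-map; length-tabulate)
open import Data.List.Relation.Unary.All as All using (All; []; _∷_)
open import Data.List.Relation.Unary.All.Properties using (¬Any⇒All¬)
open import Data.List.Relation.Unary.AllPairs using ([]; _∷_)
open import Data.List.Relation.Unary.Any as Any using (here; there; index)
open import Data.List.Relation.Unary.Unique.Propositional using (Unique)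
import Data.List.Relation.Unary.Unique.Propositional.Properties as Unique
open import Data.Nat.Base using (ℕ; zero; suc; _+_; _*_; _≤_; _<_; _≥_; z≤n; s≤s; >-nonZero)
open import Data.Nat.Combinatorics using (_C_; nCk+nC[k+1]≡[n+1]C[k+1]; nC1≡n)
open import Data.Nat.ListAction using (sum)
open import Data.Nat.Properties as ℕ using (≤-trans; ≤-reflexive; +-mono-≤; +-comm; +-assoc; *-zeroʳ)
open import Data.Nat.Tactic.RingSolver using (solve-∀)
open import Data.Product.Base using (∃; ∃-syntax; _×_; _,_; proj₁; proj₂; swap)
open import Data.Rational.Base as ℚ using (ℚ; 0ℚ; 1ℚ; mkℚ; _/_; ↧ₙ_; toℚᵘ)
import Data.Rational.Properties as ℚ
open import Data.Rational.Unnormalised.Base as ℚᵘ using (mkℚᵘ; *≤*)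
import Data.Rational.Unnormalised.Properties as ℚᵘ
open import Data.Sum.Base using (_⊎_; inj₁; inj₂; [_,_]′)
open import Data.Vec.Base using (Vec; []; _∷_; here; there; lookup; tabulate)
open import Data.Vec.Properties using (lookup∘tabulate; ∷-injective)
open import Function.Base using (_∘_; id; flip)
open import Function.Definitions using (Injective)
open import Relation.Binary.Definitions using (tri<; tri≈; tri>)
open import Relation.Binary.PropositionalEquality
  using (_≡_; _≢_; refl; sym; trans; cong; cong₂; subst; subst₂; setoid; module ≡-Reasoning)
open import Relation.Nullary using (¬_; Dec; yes; no; contradiction)
open import Relation.Nullary.Decidable using
  (True; toWitness; from-yes; decidable-stable; _×-dec_; _⊎-dec_; _→-dec_; ¬?)
open import Relation.Unary using (Decidable)

private
  variable
    A B : Set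
    k n : ℕ

-- Counting by codes, and choice of fresh elements.

lookup-injective : {xs : List A} → Unique xs → ∀ {i j} → List.lookup xs i ≡ List.lookup xs j → i ≡ j
lookup-injective (_ ∷ _) {zero} {zero} _ = refl
lookup-injective {xs = _ ∷ xs} (x∉ ∷ _) {zero} {suc j} eq = contradiction eq (All.lookup x∉ (∈-lookup j))
lookup-injective {xs = _ ∷ xs} (x∉ ∷ _) {suc i} {zero} eq = contradiction (sym eq) (All.lookup x∉ (∈-lookup i))
lookup-injective (_ ∷ u) {suc i} {suc j} eq = cong suc (lookup-injective u eq)

-- A relation takes the place of an encoding function because an object may have several codes, as a
-- 6-cycle does. It is enough that each object has some code in the list and that no code belongs to
-- two objects.
length-encode-≤ : {xs : List A} {ys : List B} (Codes : A → B → Set) →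
  Unique xs →
  (∀ {x} → x ∈ₗ xs → ∃ λ y → y ∈ₗ ys × Codes x y) →
  (∀ {x x′ y} → Codes x y → Codes x′ y → x ≡ x′) →
  length xs ≤ length ys
length-encode-≤ {A} {B} {xs} {ys} Codes u enc inj = injective⇒≤ {f = code} code-inj
  where
  enc′ : ∀ i → ∃ λ y → y ∈ₗ ys × Codes (List.lookup xs i) y
  enc′ i = enc (∈-lookup i)
  code : Fin (length xs) → Fin (length ys)
  code i = index (proj₁ (proj₂ (enc′ i)))
  code-inj : ∀ {i j} → code i ≡ code j → i ≡ j
  code-inj {i} {j} eq with enc′ i | enc′ j
  ... | y , y∈ , c | y′ , y′∈ , c′ with Membershipₛ.index-injective (setoid B) y∈ y′∈ eq
  ... | refl = lookup-injective u (inj c c′)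

length-⊆-≤ : {xs ys : List A} → Unique xs → (∀ {x} → x ∈ₗ xs → x ∈ₗ ys) → length xs ≤ length ys
length-⊆-≤ u xs⊆ys = length-encode-≤ _≡_ u (λ {x} x∈ → x , xs⊆ys x∈ , refl) λ { refl refl → refl }

fresh : {xs : List (Fin n)} (avoid : List (Fin n)) → Unique xs → length avoid < length xs →
  ∃ λ x → x ∈ₗ xs × x ∉ₗ avoid
fresh {n} {xs} avoid u lt with Any.any? (λ x → ¬? (member? Fin._≟_ x avoid)) xs
... | yes p = find p
... | no ¬p = contradiction lt (ℕ.≤⇒≯ (length-⊆-≤ u xs⊆avoid))
  where
  xs⊆avoid : ∀ {x} → x ∈ₗ xs → x ∈ₗ avoid
  xs⊆avoid {x} x∈ with member? Fin._≟_ x avoid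
  ... | yes q = q
  ... | no ¬q = contradiction (lose x∈ ¬q) ¬p

-- Finite sums over lists.

∑ : List A → (A → ℕ) → ℕ
∑ xs f = sum (map f xs)

∑-cong : (xs : List A) {f g : A → ℕ} → (∀ x → f x ≡ g x) → ∑ xs f ≡ ∑ xs g
∑-cong []       eq = refl
∑-cong (x ∷ xs) eq = cong₂ _+_ (eq x) (∑-cong xs eq)

∑-mono : (xs : List A) {f g : A → ℕ} → (∀ {x} → x ∈ₗ xs → f x ≤ g x) → ∑ xs f ≤ ∑ xs g
∑-mono []       le = z≤n
∑-mono (x ∷ xs) le = +-mono-≤ (le (here refl)) (∑-mono xs (le ∘ there))

∑-const : (xs : List A) (c : ℕ) → ∑ xs (λ _ → c) ≡ length xs * c
∑-const []       c = refl
∑-const (x ∷ xs) c = cong (_+_ c) (∑-const xs c)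

∑-≤ : (xs : List A) {f : A → ℕ} {c : ℕ} → (∀ {x} → x ∈ₗ xs → f x ≤ c) → ∑ xs f ≤ length xs * c
∑-≤ xs {c = c} le = ≤-trans (∑-mono xs le) (≤-reflexive (∑-const xs c))

∑-distrib-+ : (xs : List A) (f g : A → ℕ) → ∑ xs (λ x → f x + g x) ≡ ∑ xs f + ∑ xs g
∑-distrib-+ []       f g = refl
∑-distrib-+ (x ∷ xs) f g rewrite ∑-distrib-+ xs f g = interchange (f x) (g x) (∑ xs f) (∑ xs g)
  where open import Algebra.Properties.CommutativeSemigroup ℕ.+-commutativeSemigroup using (interchange)

*-distribˡ-∑ : ∀ c (xs : List A) (f : A → ℕ) → c * ∑ xs f ≡ ∑ xs (λ x → c * f x)
*-distribˡ-∑ c []       f = *-zeroʳ c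
*-distribˡ-∑ c (x ∷ xs) f = trans (ℕ.*-distribˡ-+ c (f x) _) (cong (_+_ (c * f x)) (*-distribˡ-∑ c xs f))

*-distribʳ-∑ : ∀ c (xs : List A) (f : A → ℕ) → ∑ xs f * c ≡ ∑ xs (λ x → f x * c)
*-distribʳ-∑ c []       f = refl
*-distribʳ-∑ c (x ∷ xs) f = trans (ℕ.*-distribʳ-+ c (f x) _) (cong (_+_ (f x * c)) (*-distribʳ-∑ c xs f))

∑-comm : (xs : List A) (ys : List B) (f : A → B → ℕ) →
  ∑ xs (λ x → ∑ ys (f x)) ≡ ∑ ys (λ y → ∑ xs (λ x → f x y))
∑-comm []       ys f = sym (trans (∑-const ys 0) (*-zeroʳ (length ys)))
∑-comm (x ∷ xs) ys f = trans (cong (_+_ (∑ ys (f x))) (∑-comm xs ys f)) (sym (∑-distrib-+ ys (f x) _))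

length-concatMap : (f : A → List B) (xs : List A) → length (concatMap f xs) ≡ ∑ xs (length ∘ f)
length-concatMap f []       = refl
length-concatMap f (x ∷ xs) = trans (length-++ (f x)) (cong (_+_ (length (f x))) (length-concatMap f xs))

∑-filter-≤ : {P : A → Set} (P? : Decidable P) (xs : List A) (f : A → ℕ) → ∑ (filter P? xs) f ≤ ∑ xs f
∑-filter-≤ P? []       f = z≤n
∑-filter-≤ P? (x ∷ xs) f with P? x
... | yes _ = ℕ.+-monoʳ-≤ (f x) (∑-filter-≤ P? xs f)
... | no _  = ≤-trans (∑-filter-≤ P? xs f) (ℕ.m≤n+m _ (f x))

indicator : {P : Set} → Dec P → ℕ
indicator (yes _) = 1
indicator (no _)  = 0

length-filter-∑ : {P : A → Set} (P? : Decidable P) (xs : List A) → length (filter P? xs) ≡ ∑ xs (indicator ∘ P?)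
length-filter-∑ P? []       = refl
length-filter-∑ P? (x ∷ xs) with P? x
... | yes _ = cong suc (length-filter-∑ P? xs)
... | no _  = length-filter-∑ P? xs


-- Counting vertices with a decidable property.

length-allFin : ∀ n → length (allFin n) ≡ n
length-allFin n = length-tabulate id

select : {P : Fin n → Set} → Decidable P → List (Fin n)
select P? = filter P? (allFin _)

#[_] : {P : Fin n → Set} → Decidable P → ℕ
#[ P? ] = length (select P?)

module _ {P : Fin n → Set} (P? : Decidable P) where

  ∈-select⁺ : ∀ {v} → P v → v ∈ₗ select P?
  ∈-select⁺ p = ∈-filter⁺ P? (∈-allFin _) p

  ∈-select⁻ : ∀ {v} → v ∈ₗ select P? → P v
  ∈-select⁻ v∈ = proj₂ (∈-filter⁻ P? {xs = allFin _} v∈)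

  select-unique : Unique (select P?)
  select-unique = Unique.filter⁺ P? (Unique.allFin⁺ n)

  fresh-select : (avoid : List (Fin n)) → length avoid < #[ P? ] → ∃ λ v → P v × v ∉ₗ avoid
  fresh-select avoid lt with fresh avoid select-unique lt
  ... | v , v∈ , v∉ = v , ∈-select⁻ v∈ , v∉

  #-≤-list : (xs : List (Fin n)) → (∀ {v} → P v → v ∈ₗ xs) → #[ P? ] ≤ length xs
  #-≤-list xs P⊆ = length-⊆-≤ select-unique (λ v∈ → P⊆ (∈-select⁻ v∈))

module _ {P Q : Fin n → Set} (P? : Decidable P) (Q? : Decidable Q) where

  #-mono : (∀ {v} → P v → Q v) → #[ P? ] ≤ #[ Q? ]
  #-mono P⊆Q = #-≤-list P? (select Q?) (λ p → ∈-select⁺ Q? (P⊆Q p))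

  #-inclusion-exclusion : #[ P? ] + #[ Q? ] ≤ n + #[ (λ v → P? v ×-dec Q? v) ]
  #-inclusion-exclusion = subst (λ m → #[ P? ] + #[ Q? ] ≤ m + #[ PQ? ]) (length-allFin n) (go (allFin n))
    where
    PQ? : Decidable (λ v → P v × Q v)
    PQ? v = P? v ×-dec Q? v
    go : ∀ xs → length (filter P? xs) + length (filter Q? xs) ≤ length xs + length (filter PQ? xs)
    go [] = z≤n
    go (x ∷ xs) with P? x | Q? x
    ... | yes _ | yes _ rewrite ℕ.+-suc (length (filter P? xs)) (length (filter Q? xs))
                              | ℕ.+-suc (length xs) (length (filter PQ? xs)) = s≤s (s≤s (go xs))
    ... | yes _ | no _  = s≤s (go xs)
    ... | no _  | yes _ rewrite ℕ.+-suc (length (filter P? xs)) (length (filter Q? xs)) = s≤s (go xs)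
    ... | no _  | no _  = ℕ.m≤n⇒m≤1+n (go xs)

#-∪ : {P Q R : Fin n → Set} (P? : Decidable P) (Q? : Decidable Q) (R? : Decidable R) →
  (∀ {v} → P v → Q v ⊎ R v) → #[ P? ] ≤ #[ Q? ] + #[ R? ]
#-∪ P? Q? R? P⊆ = ≤-trans
  (#-≤-list P? (select Q? ++ select R?)
    (λ p → [ ∈-++⁺ˡ ∘ ∈-select⁺ Q? , ∈-++⁺ʳ (select Q?) ∘ ∈-select⁺ R? ]′ (P⊆ p)))
  (≤-reflexive (length-++ (select Q?)))

elements : Subset n → List (Fin n)
elements []            = []
elements (inside  ∷ p) = zero ∷ map suc (elements p)
elements (outside ∷ p) = map suc (elements p)

length-elements : (p : Subset n) → length (elements p) ≡ ∣ p ∣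
length-elements []            = refl
length-elements (inside  ∷ p) = cong suc (trans (length-map suc (elements p)) (length-elements p))
length-elements (outside ∷ p) = trans (length-map suc (elements p)) (length-elements p)

∈-elements : {p : Subset n} {v : Fin n} → v ∈ p → v ∈ₗ elements p
∈-elements here                         = here refl
∈-elements {p = inside  ∷ _} (there v∈) = there (∈-map⁺ suc (∈-elements v∈))
∈-elements {p = outside ∷ _} (there v∈) = ∈-map⁺ suc (∈-elements v∈)

#-≤-∣∣ : {P : Fin n → Set} (P? : Decidable P) (p : Subset n) → (∀ {v} → P v → v ∈ p) → #[ P? ] ≤ ∣ p ∣
#-≤-∣∣ P? p P⊆p = ≤-trans (#-≤-list P? (elements p) (λ q → ∈-elements (P⊆p q))) (≤-reflexive (length-elements p))

-- Copies of a graph and the maps onto them.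

Homomorphism : Graph k → Graph n → (Fin k → Fin n) → Set
Homomorphism F G f = ∀ i j → j ∈ N F i → f j ∈ N G (f i)

module _ (F : Graph k) (G : Graph n) (f : Fin k → Fin n) where

  private
    InImage : Fin n → Set
    InImage v = ∃ λ i → f i ≡ v
    inImage? : Decidable InImage
    inImage? v = any? λ i → f i Fin.≟ v
    Edge : Fin n → Fin n → Set
    Edge u v = ∃ λ i → ∃ λ j → j ∈ N F i × f i ≡ u × f j ≡ v
    edge? : ∀ u → Decidable (Edge u)
    edge? u v = any? λ i → any? λ j → (j ∈? N F i) ×-dec (f i Fin.≟ u) ×-dec (f j Fin.≟ v)
    neighbourhood : Fin n → Subset n
    neighbourhood u = toSubset (Edge u) (edge? u)

  image : PreSubgraph n
  image = toSubset InImage inImage? , tabulate neighbourhood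

  private
    edge⁻ : ∀ {u v} → v ∈ Nₛ image u → Edge u v
    edge⁻ {u} v∈ = ∈-toSubset⁻ (Edge u) (edge? u) (subst (_ ∈_) (lookup∘tabulate neighbourhood u) v∈)
    edge⁺ : ∀ {u v} → Edge u v → v ∈ Nₛ image u
    edge⁺ {u} e = subst (_ ∈_) (sym (lookup∘tabulate neighbourhood u)) (∈-toSubset⁺ (Edge u) (edge? u) e)

  -- The edges of `image` are only the images of edges of `F`, so the copy need not be induced;
  -- injectivity recovers an edge of `F` from the ends of its image.
  image-isCopy : Injective _≡_ _≡_ f → Homomorphism F G f → IsCopy F G image
  image-isCopy inj hom = (edges , symm , ends) , f , inj , into , onto , adj
    where
    into : ∀ i → f i ∈ V image
    into i = ∈-toSubset⁺ InImage inImage? (i , refl)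
    onto : ∀ v → v ∈ V image → ∃ λ i → f i ≡ v
    onto v = ∈-toSubset⁻ InImage inImage?
    edges : ∀ u → Nₛ image u ⊆ N G u
    edges u v∈ with edge⁻ v∈
    ... | i , j , j∈ , refl , refl = hom i j j∈
    symm : ∀ u v → v ∈ Nₛ image u → u ∈ Nₛ image v
    symm u v v∈ with edge⁻ v∈
    ... | i , j , j∈ , p , q = edge⁺ (j , i , Graph.N-sym F j∈ , q , p)
    ends : ∀ u v → v ∈ Nₛ image u → u ∈ V image × v ∈ V image
    ends u v v∈ with edge⁻ v∈
    ... | i , j , _ , refl , refl = into i , into j
    adj : ∀ i j → (j ∈ N F i → f j ∈ Nₛ image (f i)) × (f j ∈ Nₛ image (f i) → j ∈ N F i)
    adj i j = (λ j∈ → edge⁺ (i , j , j∈ , refl , refl)) , λ fj∈ → back (edge⁻ fj∈)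
      where
      back : Edge (f i) (f j) → j ∈ N F i
      back (i′ , j′ , j∈ , p , q) = subst₂ (λ x y → y ∈ N F x) (inj p) (inj q) j∈

-- The vertex set of a copy is the range of `f` and its edges are the images of the edges of `F`.
-- Hence the vertices of a cycle, listed in order, determine it.
isIso-unique : (F : Graph k) (G : Graph n) {H H′ : PreSubgraph n} {f : Fin k → Fin n} →
  IsSubgraph G H → IsIso F H f → IsSubgraph G H′ → IsIso F H′ f → H ≡ H′
isIso-unique {n = n} F G {H} {H′} {f} sub iso sub′ iso′ =
  cong₂ _,_ (⊆-antisym (V⊆ {H} {H′} iso iso′) (V⊆ {H′} {H} iso′ iso))
    (lookup-ext (λ u → ⊆-antisym (N⊆ {H} {H′} sub iso iso′ u) (N⊆ {H′} {H} sub′ iso′ iso u)))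
  where
  V⊆ : ∀ {H H′ : PreSubgraph n} → IsIso F H f → IsIso F H′ f → V H ⊆ V H′
  V⊆ (_ , _ , onto , _) (_ , into′ , _) {v} v∈ with onto v v∈
  ... | i , refl = into′ i
  N⊆ : ∀ {H H′ : PreSubgraph n} → IsSubgraph G H → IsIso F H f → IsIso F H′ f → ∀ u → Nₛ H u ⊆ Nₛ H′ u
  N⊆ (_ , _ , ends) (_ , _ , onto , adj) (_ , _ , _ , adj′) u {v} v∈ with ends u v v∈
  ... | u∈V , v∈V with onto u u∈V | onto v v∈V
  ... | i , refl | j , refl = proj₁ (adj′ i j) (proj₂ (adj i j) v∈)
  lookup-ext : ∀ {m} {xs ys : Vec (Subset n) m} → (∀ i → lookup xs i ≡ lookup ys i) → xs ≡ ys
  lookup-ext {xs = []}     {[]}     eq = refl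
  lookup-ext {xs = _ ∷ _}  {_ ∷ _}  eq = cong₂ _∷_ (eq zero) (lookup-ext (eq ∘ suc))

-- `F` as a subgraph of itself, so that `IsIso F (whole F)` says that a map is an automorphism of
-- `F`.
whole : Graph k → PreSubgraph k
whole F = ⊤ , tabulate (N F)

isIso-∘ : (F : Graph k) (H : PreSubgraph n) {σ : Fin k → Fin k} {f : Fin k → Fin n} →
  IsIso F (whole F) σ → IsIso F H f → IsIso F H (f ∘ σ)
isIso-∘ F H {σ} {f} (σ-inj , _ , σ-onto , σ-adj) (inj , into , onto , adj) =
    (λ eq → σ-inj (inj eq))
  , (λ i → into (σ i))
  , (λ v v∈ → surj v (onto v v∈))
  , λ i j → (λ j∈ → proj₁ (adj (σ i) (σ j)) (subst (σ j ∈_) (N≡ i) (proj₁ (σ-adj i j) j∈)))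
          , (λ fj∈ → proj₂ (σ-adj i j) (subst (σ j ∈_) (sym (N≡ i)) (proj₂ (adj (σ i) (σ j)) fj∈)))
  where
  N≡ : ∀ i → Nₛ (whole F) (σ i) ≡ N F (σ i)
  N≡ i = lookup∘tabulate (N F) (σ i)
  surj : ∀ v → (∃ λ i → f i ≡ v) → ∃ λ i → f (σ i) ≡ v
  surj v (i , refl) with σ-onto i ∈⊤
  ... | j , refl = j , refl


module _ {H : PreSubgraph n} {x a y b z c : Fin n} where

  -- Here and for `reflect`, evaluation of the decision procedure shows that `σ` is an automorphism
  -- of the 6-cycle.
  rotate : IsIso (Cycle 6) H (lookup (x ∷ a ∷ y ∷ b ∷ z ∷ c ∷ [])) →
           IsIso (Cycle 6) H (lookup (a ∷ y ∷ b ∷ z ∷ c ∷ x ∷ []))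
  rotate iso = isIso-resp-≗ (Cycle 6) H
    (λ { 0F → refl ; 1F → refl ; 2F → refl ; 3F → refl ; 4F → refl ; 5F → refl })
    (isIso-∘ (Cycle 6) H {σ} (from-yes (isIso? (Cycle 6) (whole (Cycle 6)) σ)) iso)
    where
    σ : Fin 6 → Fin 6
    σ = lookup (1F ∷ 2F ∷ 3F ∷ 4F ∷ 5F ∷ 0F ∷ [])

  reflect : IsIso (Cycle 6) H (lookup (x ∷ a ∷ y ∷ b ∷ z ∷ c ∷ [])) →
            IsIso (Cycle 6) H (lookup (z ∷ b ∷ y ∷ a ∷ x ∷ c ∷ []))
  reflect iso = isIso-resp-≗ (Cycle 6) H
    (λ { 0F → refl ; 1F → refl ; 2F → refl ; 3F → refl ; 4F → refl ; 5F → refl })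
    (isIso-∘ (Cycle 6) H {σ} (from-yes (isIso? (Cycle 6) (whole (Cycle 6)) σ)) iso)
    where
    σ : Fin 6 → Fin 6
    σ = lookup (4F ∷ 3F ∷ 2F ∷ 1F ∷ 0F ∷ 5F ∷ [])

-- Edge counts of bipartite graphs, and peeling.

Decidable₂ : (Fin n → Fin n → Set) → Set
Decidable₂ E = ∀ a b → Dec (E a b)

-- A relation is read as a bipartite graph between two copies of the vertex set, and this is its
-- number of edges.
size : {E : Fin n → Fin n → Set} → Decidable₂ E → ℕ
size {n} E? = ∑ (allFin n) (λ a → #[ E? a ])

size-flip : {E : Fin n → Fin n → Set} (E? : Decidable₂ E) → size E? ≡ size (flip E?)
size-flip {n} E? = trans (expand E?) (trans (∑-comm (allFin n) (allFin n) _) (sym (expand (flip E?))))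
  where
  expand : {E : Fin n → Fin n → Set} (E? : Decidable₂ E) →
    size E? ≡ ∑ (allFin n) (λ a → ∑ (allFin n) (λ b → indicator (E? a b)))
  expand E? = ∑-cong (allFin n) (λ a → length-filter-∑ (E? a) (allFin n))

size-mono-+ : {E E′ : Fin n → Fin n → Set} (E? : Decidable₂ E) (E′? : Decidable₂ E′) (c : ℕ) →
  (∀ a → #[ E? a ] ≤ #[ E′? a ] + c) → size E? ≤ size E′? + n * c
size-mono-+ {n} E? E′? c le = ≤-trans (∑-mono (allFin n) (λ {a} _ → le a))
  (≤-reflexive (trans (∑-distrib-+ (allFin n) _ _)
    (cong (_+_ (size E′?)) (trans (∑-const (allFin n) c) (cong (_* c) (length-allFin n))))))

size-∪ : {E E₁ E₂ : Fin n → Fin n → Set} (E? : Decidable₂ E) (E₁? : Decidable₂ E₁) (E₂? : Decidable₂ E₂) →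
  (∀ {a b} → E a b → E₁ a b ⊎ E₂ a b) → size E? ≤ size E₁? + size E₂?
size-∪ {n} E? E₁? E₂? E⊆ = ≤-trans
  (∑-mono (allFin n) (λ {a} _ → #-∪ (E? a) (E₁? a) (E₂? a) E⊆))
  (≤-reflexive (∑-distrib-+ (allFin n) _ _))

size-empty : {E : Fin n → Fin n → Set} (E? : Decidable₂ E) → (∀ {a b} → ¬ E a b) → size E? ≡ 0
size-empty {n} E? ¬E = ℕ.n≤0⇒n≡0 (≤-trans
  (∑-≤ (allFin n) (λ {a} _ → #-≤-list (E? a) [] (λ e → contradiction e ¬E)))
  (≤-reflexive (*-zeroʳ (length (allFin n)))))

-- A bipartite graph E with more than 2kn edges keeps an edge after the
-- edges at left vertices of degree ≤ k, and then those at right vertices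
-- of degree ≤ k, are deleted; surviving edges extend to paths avoiding
-- any few vertices.  Iterating yields long paths.
module _ (k : ℕ) {E : Fin n → Fin n → Set} (E? : Decidable₂ E) where

  abstract
    Rich : Fin n → Fin n → Set
    Rich a b = E a b × k < #[ E? a ]

    rich? : Decidable₂ Rich
    rich? a b = E? a b ×-dec (k ℕ.<? #[ E? a ])

    size-rich : size E? ≤ size rich? + n * k
    size-rich = size-mono-+ E? rich? k bound
      where
      bound : ∀ a → #[ E? a ] ≤ #[ rich? a ] + k
      bound a with k ℕ.<? #[ E? a ]
      ... | yes k< = ≤-trans (#-mono (E? a) _ (λ e → e , k<)) (ℕ.m≤m+n _ k)
      ... | no k≮  = ≤-trans (ℕ.≮⇒≥ k≮) (ℕ.m≤n+m k _)

    Peel : Fin n → Fin n → Set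
    Peel a b = Rich a b × k < #[ flip rich? b ]

    peel? : Decidable₂ Peel
    peel? a b = rich? a b ×-dec (k ℕ.<? #[ flip rich? b ])

    size-peel : size E? ≤ size peel? + (n * k + n * k)
    size-peel = begin
      size E?                                ≤⟨ size-rich ⟩
      size rich? + n * k                     ≡⟨ cong (_+ n * k) (size-flip rich?) ⟩
      size (flip rich?) + n * k              ≤⟨ ℕ.+-monoˡ-≤ (n * k) (size-mono-+ (flip rich?) (flip peel?) k bound) ⟩
      size (flip peel?) + n * k + n * k      ≡⟨ cong (λ m → m + n * k + n * k) (sym (size-flip peel?)) ⟩
      size peel? + n * k + n * k             ≡⟨ +-assoc (size peel?) (n * k) (n * k) ⟩
      size peel? + (n * k + n * k)           ∎
      where
      open ℕ.≤-Reasoning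
      bound : ∀ b → #[ flip rich? b ] ≤ #[ flip peel? b ] + k
      bound b with k ℕ.<? #[ flip rich? b ]
      ... | yes k< = ≤-trans (#-mono (flip rich? b) _ (λ e → e , k<)) (ℕ.m≤m+n _ k)
      ... | no k≮  = ≤-trans (ℕ.≮⇒≥ k≮) (ℕ.m≤n+m k _)

    Peel⊆ : ∀ {a b} → Peel a b → E a b
    Peel⊆ ((e , _) , _) = e

    -- The new edges lie in `E`, one level below `Peel`: each extension of a path by two edges uses
    -- up one round of peeling.
    extend : ∀ {a b} → Peel a b → (avoid : List (Fin n)) → length avoid < k →
      ∃ λ a′ → ∃ λ b′ → E a′ b × E a′ b′ × a′ ∉ₗ avoid × b′ ∉ₗ a′ ∷ avoid
    extend {a} {b} (_ , k<) avoid short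
      with fresh-select (flip rich? b) avoid (ℕ.<-trans short k<)
    ... | a′ , (e , k<′) , a′∉ with fresh-select (E? a′) (a′ ∷ avoid) (ℕ.≤-<-trans short k<′)
    ... | b′ , e′ , b′∉ = a′ , b′ , e , e′ , a′∉ , b′∉

-- Distinctness and enumeration in lists.

_∉∷_ : ∀ {x y : Fin n} {xs} → x ≢ y → x ∉ₗ xs → x ∉ₗ y ∷ xs
(x≢y ∉∷ x∉) (here eq)  = x≢y eq
(x≢y ∉∷ x∉) (there x∈) = x∉ x∈

infixr 5 _∉∷_

∉[] : ∀ {x : Fin n} → x ∉ₗ []
∉[] ()

subfamily : {m : ℕ} {xs : List (Fin n)} → Unique xs → (σ : Vec (Fin (length xs)) m) →
  {True (injective? (lookup σ))} → Unique (List.tabulate (List.lookup xs ∘ lookup σ))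
subfamily u σ {σ-inj} = Unique.tabulate⁺ (λ eq → toWitness σ-inj (lookup-injective u eq))

length-concatMap-≤ : (f : A → List B) (xs : List A) {c : ℕ} → (∀ {x} → x ∈ₗ xs → length (f x) ≤ c) →
  length (concatMap f xs) ≤ length xs * c
length-concatMap-≤ f xs le = ≤-trans (≤-reflexive (length-concatMap f xs)) (∑-≤ xs le)

-- The bound length (f x) ≤ (d - c)/q with both sides moved, so that
-- neither division nor subtraction occurs.
length-concatMap-deficit : (f : A → List B) (xs : List A) {q c d : ℕ} → (∀ x → q * length (f x) + c ≤ d) →
  q * length (concatMap f xs) + length xs * c ≤ length xs * d
length-concatMap-deficit f [] {q} le = ≤-reflexive (trans (ℕ.+-identityʳ (q * 0)) (*-zeroʳ q))
length-concatMap-deficit f (x ∷ xs) {q} {c} {d} le = begin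
  q * length (f x ++ concatMap f xs) + (c + length xs * c)
    ≡⟨ cong (λ m → q * m + (c + length xs * c)) (length-++ (f x)) ⟩
  q * (length (f x) + length (concatMap f xs)) + (c + length xs * c)
    ≡⟨ regroup q (length (f x)) (length (concatMap f xs)) c (length xs * c) ⟩
  (q * length (f x) + c) + (q * length (concatMap f xs) + length xs * c)
    ≤⟨ +-mono-≤ (le x) (length-concatMap-deficit f xs {q} le) ⟩
  d + length xs * d ∎
  where
  open ℕ.≤-Reasoning
  regroup : ∀ q l m c r → q * (l + m) + (c + r) ≡ (q * l + c) + (q * m + r)
  regroup = solve-∀

∈-concatMap : {f : A → List B} {xs : List A} {x : A} {y : B} → x ∈ₗ xs → y ∈ₗ f x → y ∈ₗ concatMap f xs
∈-concatMap {f = f} x∈ y∈ = ∈-concatMap⁺ f (lose x∈ y∈)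

vectors-unique : {xs : List A} → Unique xs → ∀ m → Unique (vectors xs m)
vectors-unique u zero    = [] ∷ []
vectors-unique u (suc m) = Unique.cartesianProductWith⁺ _∷_ ∷-injective u (vectors-unique u m)

preSubgraphs-unique : ∀ n → Unique (preSubgraphs n)
preSubgraphs-unique n = Unique.cartesianProduct⁺ subsets-unique (vectors-unique subsets-unique n)
  where
  subsets-unique : Unique (subsets n)
  subsets-unique = vectors-unique (((λ ()) ∷ []) ∷ [] ∷ []) n

pattern 1st = here refl
pattern 2nd = there (here refl)
pattern 3rd = there (there (here refl))

-- Arithmetic: the size of `R` and the final inequality.

-- Pascal's rule gives this and the next formula by induction. They are multiplied out and shifted
-- so that neither division nor subtraction occurs.
C₂-formula : ∀ m → 2 * (suc m C 2) ≡ suc m * m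
C₂-formula zero    = refl
C₂-formula (suc m) = begin
  2 * (suc (suc m) C 2)               ≡⟨ cong (2 *_) (sym (nCk+nC[k+1]≡[n+1]C[k+1] (suc m) 1)) ⟩
  2 * (suc m C 1 + suc m C 2)         ≡⟨ cong (λ c → 2 * (c + suc m C 2)) (nC1≡n (suc m)) ⟩
  2 * (suc m + suc m C 2)             ≡⟨ ℕ.*-distribˡ-+ 2 (suc m) (suc m C 2) ⟩
  2 * suc m + 2 * (suc m C 2)         ≡⟨ cong (λ c → 2 * suc m + c) (C₂-formula m) ⟩
  2 * suc m + suc m * m               ≡⟨ collect m ⟩
  suc (suc m) * suc m                 ∎
  where
  open ≡-Reasoning
  collect : ∀ m → 2 * suc m + suc m * m ≡ suc (suc m) * suc m
  collect = solve-∀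

C₃-formula : ∀ m → 6 * (suc (suc m) C 3) ≡ suc (suc m) * (suc m * m)
C₃-formula zero    = refl
C₃-formula (suc m) = begin
  6 * (suc (suc (suc m)) C 3)                            ≡⟨ cong (6 *_) (sym (nCk+nC[k+1]≡[n+1]C[k+1] (suc (suc m)) 2)) ⟩
  6 * (suc (suc m) C 2 + suc (suc m) C 3)                ≡⟨ split (suc (suc m) C 2) (suc (suc m) C 3) ⟩
  3 * (2 * (suc (suc m) C 2)) + 6 * (suc (suc m) C 3)    ≡⟨ cong₂ (λ a b → 3 * a + b) (C₂-formula (suc m)) (C₃-formula m) ⟩
  3 * (suc (suc m) * suc m) + suc (suc m) * (suc m * m)  ≡⟨ collect m ⟩
  suc (suc (suc m)) * (suc (suc m) * suc m)              ∎
  where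
  open ≡-Reasoning
  split : ∀ a b → 6 * (a + b) ≡ 3 * (2 * a) + 6 * b
  split = solve-∀
  collect : ∀ m → 3 * (suc (suc m) * suc m) + suc (suc m) * (suc m * m) ≡ suc (suc (suc m)) * (suc (suc m) * suc m)
  collect = solve-∀

-- For n = m + 5 the binomial term of `R` is (m + 2)(m + 1)m, and adding 12n² to it exceeds n³ by
-- exactly 175 + 47m. The linear term of `R` is given away.
n³-≤-R : ∀ {n} → 5 ≤ n → n * (n * n) ≤ R n + 12 * (n * n)
n³-≤-R {suc (suc (suc (suc (suc m))))} (s≤s (s≤s (s≤s (s≤s (s≤s z≤n))))) = begin
  n′ * (n′ * n′)                                                ≤⟨ ℕ.m≤m+n _ (175 + 47 * m) ⟩
  n′ * (n′ * n′) + (175 + 47 * m)                               ≡⟨ expand m ⟩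
  suc (suc m) * (suc m * m) + 12 * (n′ * n′)                   ≡⟨ cong (_+ 12 * (n′ * n′)) (sym (C₃-formula m)) ⟩
  6 * (suc (suc m) C 3) + 12 * (n′ * n′)                       ≤⟨ ℕ.+-monoˡ-≤ (12 * (n′ * n′)) (ℕ.m≤m+n _ (12 * m)) ⟩
  R n′ + 12 * (n′ * n′)                                         ∎
  where
  open ℕ.≤-Reasoning
  n′ = 5 + m
  expand : ∀ m → (5 + m) * ((5 + m) * (5 + m)) + (175 + 47 * m) ≡ (2 + m) * ((1 + m) * m) + 12 * ((5 + m) * (5 + m))
  expand = solve-∀

abstract
  -- The coefficient of n² that remains when `t` times n³ is compared with the cubic error
  -- `Q * (k * c)` times n³. As `t` is larger by one, a single n³ survives on the left.
  threshold : (Q c k : ℕ) → ℕ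
  threshold Q c k = Q * (c * (t * t)) + 12 * (Q * t)
    where
    t : ℕ
    t = suc (Q * (k * c))

  -- T, F and D are the numbers of thin codes, of fat codes, and of edge ends.
  -- The free parameter t of the degree bound is chosen to make the cubic
  -- contribution of T smaller than the gain n³ in the bound for F.
  n≤threshold : ∀ n Q c k {T F D} → 0 < n →
    n * (n * n) ≤ T + F + 12 * (n * n) →
    T ≤ D * (n * c) →
    (∀ t → t * D ≤ n * (t * t) + n * (n * k)) →
    Q * F + n * (n * n) ≤ n * (n * (Q * n)) →
    n ≤ threshold Q c k
  n≤threshold n Q c k {T} {F} {D} 0<n total thin degrees fat =
    ℕ.*-cancelʳ-≤ n (threshold Q c k) (n * n) {{>-nonZero (ℕ.*-mono-< 0<n 0<n)}}
      (ℕ.+-cancelˡ-≤ (Q * (k * c) * (n * (n * n))) _ _ cubic)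
    where
    open ℕ.≤-Reasoning
    t : ℕ
    t = suc (Q * (k * c))
    n³ : ℕ
    n³ = n * (n * n)
    regroup₁ : ∀ n Q T F → Q * (T + F + 12 * (n * n)) + n * (n * n) ≡ Q * T + 12 * (Q * (n * n)) + (Q * F + n * (n * n))
    regroup₁ = solve-∀
    regroup₂ : ∀ n Q X → X + n * (n * (Q * n)) ≡ Q * (n * (n * n)) + X
    regroup₂ = solve-∀
    -- Multiplying `total` by `Q` and inserting `fat` eliminates `F`; what survives is the gain n³
    -- of `fat`.
    step : n³ ≤ Q * T + 12 * (Q * (n * n))
    step = ℕ.+-cancelˡ-≤ (Q * n³) _ _ (begin
      Q * n³ + n³                                            ≤⟨ ℕ.+-monoˡ-≤ n³ (ℕ.*-monoʳ-≤ Q total) ⟩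
      Q * (T + F + 12 * (n * n)) + n³                        ≡⟨ regroup₁ n Q T F ⟩
      Q * T + 12 * (Q * (n * n)) + (Q * F + n³)              ≤⟨ ℕ.+-monoʳ-≤ (Q * T + 12 * (Q * (n * n))) fat ⟩
      Q * T + 12 * (Q * (n * n)) + n * (n * (Q * n))         ≡⟨ regroup₂ n Q (Q * T + 12 * (Q * (n * n))) ⟩
      Q * n³ + (Q * T + 12 * (Q * (n * n)))                  ∎)
    distribute : ∀ t n Q D c → t * (Q * (D * (n * c)) + 12 * (Q * (n * n))) ≡ Q * (t * D * (n * c)) + 12 * (Q * t) * (n * n)
    distribute = solve-∀
    collect : ∀ t n Q c k → Q * ((n * (t * t) + n * (n * k)) * (n * c)) + 12 * (Q * t) * (n * n)
      ≡ Q * (k * c) * (n * (n * n)) + (Q * (c * (t * t)) + 12 * (Q * t)) * (n * n)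
    collect = solve-∀
    cubic : Q * (k * c) * n³ + n * (n * n) ≤ Q * (k * c) * n³ + threshold Q c k * (n * n)
    cubic = begin
      Q * (k * c) * n³ + n³                                                      ≡⟨ +-comm (Q * (k * c) * n³) n³ ⟩
      t * n³                                                                     ≤⟨ ℕ.*-monoʳ-≤ t step ⟩
      t * (Q * T + 12 * (Q * (n * n)))                                           ≤⟨ ℕ.*-monoʳ-≤ t
                                                                                      (ℕ.+-monoˡ-≤ (12 * (Q * (n * n))) (ℕ.*-monoʳ-≤ Q thin)) ⟩
      t * (Q * (D * (n * c)) + 12 * (Q * (n * n)))                               ≡⟨ distribute t n Q D c ⟩
      Q * (t * D * (n * c)) + 12 * (Q * t) * (n * n)                             ≤⟨ ℕ.+-monoˡ-≤ (12 * (Q * t) * (n * n))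
                                                                                      (ℕ.*-monoʳ-≤ Q (ℕ.*-monoˡ-≤ (n * c) (degrees t))) ⟩
      Q * ((n * (t * t) + n * (n * k)) * (n * c)) + 12 * (Q * t) * (n * n)       ≡⟨ collect t n Q c k ⟩
      Q * (k * c) * n³ + threshold Q c k * (n * n)                               ∎

-- A positive δ is at least the reciprocal of its denominator, so it suffices to have the inequality
-- for that reciprocal. All the combinatorics can then be done in natural numbers.
proportion : (δ : ℚ) → 0ℚ ℚ.< δ → ∀ {m n} → ↧ₙ δ * n ≤ ↧ₙ δ * m + n →
  + m / 1 ℚ.≥ (1ℚ ℚ.- δ) ℚ.* (+ n / 1)
proportion (mkℚ -[1+ _ ] _ _) (ℚ.*<* ()) _
proportion (mkℚ (+ 0) _ _) (ℚ.*<* (ℤ.+<+ ())) _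
proportion δ@(mkℚ (+ suc p) d _) _ {m} {n} le = ℚ.toℚᵘ-cancel-≤ (begin
  toℚᵘ ((1ℚ ℚ.- δ) ℚ.* (+ n / 1))               ≃⟨ ℚ.toℚᵘ-homo-* (1ℚ ℚ.- δ) (+ n / 1) ⟩
  toℚᵘ (1ℚ ℚ.- δ) ℚᵘ.* toℚᵘ (+ n / 1)           ≃⟨ ℚᵘ.*-cong difference (ℚ.toℚᵘ-fromℚᵘ (mkℚᵘ (+ n) 0)) ⟩
  (mkℚᵘ (+ 1) 0 ℚᵘ.- mkℚᵘ (+ suc p) d) ℚᵘ.* mkℚᵘ (+ n) 0   ≤⟨ *≤* core ⟩
  mkℚᵘ (+ m) 0                                  ≃⟨ ℚᵘ.≃-sym (ℚ.toℚᵘ-fromℚᵘ (mkℚᵘ (+ m) 0)) ⟩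
  toℚᵘ (+ m / 1)                                ∎)
  where
  open ℚᵘ.≤-Reasoning
  difference : toℚᵘ (1ℚ ℚ.- δ) ℚᵘ.≃ mkℚᵘ (+ 1) 0 ℚᵘ.- mkℚᵘ (+ suc p) d
  difference = ℚᵘ.≃-trans (ℚ.toℚᵘ-homo-+ 1ℚ (ℚ.- δ)) (ℚᵘ.+-congʳ (mkℚᵘ (+ 1) 0) (ℚ.toℚᵘ-homo‿- δ))
  q = suc d
  core : (+ 1 ℤ.* + q ℤ.+ (ℤ.- (+ suc p)) ℤ.* + 1) ℤ.* + n ℤ.* + 1 ℤ.≤ + m ℤ.* + (1 * q * 1)
  core = ℤ.≤-trans (ℤ.≤-reflexive (left (+ q) (+ suc p) (+ n)))
    (ℤ.≤-trans (ℤ.+-monoˡ-≤ (ℤ.- (+ suc p ℤ.* + n)) cast)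
      (ℤ.≤-reflexive (trans (right (+ q) (+ suc p) (+ n) (+ m))
        (cong (λ e → + m ℤ.* + e) (sym (trans (ℕ.*-identityʳ (1 * q)) (ℕ.*-identityˡ q)))))))
    where
    left : ∀ q s n → (+ 1 ℤ.* q ℤ.+ (ℤ.- s) ℤ.* + 1) ℤ.* n ℤ.* + 1 ≡ q ℤ.* n ℤ.+ ℤ.- (s ℤ.* n)
    left = ℤ-solver.solve-∀
    right : ∀ q s n m → (q ℤ.* m ℤ.+ s ℤ.* n) ℤ.+ ℤ.- (s ℤ.* n) ≡ m ℤ.* q
    right = ℤ-solver.solve-∀
    cast : + q ℤ.* + n ℤ.≤ + q ℤ.* + m ℤ.+ + suc p ℤ.* + n
    cast = subst₂ ℤ._≤_ (ℤ.pos-* q n) (trans (ℤ.pos-+ (q * m) (suc p * n)) (cong₂ ℤ._+_ (ℤ.pos-* q m) (ℤ.pos-* (suc p) n)))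
      (ℤ.+≤+ (≤-trans le (ℕ.+-monoʳ-≤ (q * m) (ℕ.m≤m+n n (p * n)))))

-- Hexagons and octagons in a C₈-free graph.

module OctagonFree (G : Graph n) (free : Free (Cycle 8) G) where

  infix 4 _~_ _~?_

  _~_ : Fin n → Fin n → Set
  u ~ v = v ∈ N G u

  _~?_ : ∀ u v → Dec (u ~ v)
  u ~? v = v ∈? N G u

  ~-sym : ∀ {u v} → u ~ v → v ~ u
  ~-sym = Graph.N-sym G

  ~⇒≢ : ∀ {u v} → u ~ v → u ≢ v
  ~⇒≢ u~v refl = Graph.N-irrefl G u~v

  record Hexagon (x a y b z c : Fin n) : Set where
    constructor hexagon
    field
      distinct : Unique (x ∷ a ∷ y ∷ b ∷ z ∷ c ∷ [])
      x~a : x ~ a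
      a~y : a ~ y
      y~b : y ~ b
      b~z : b ~ z
      z~c : z ~ c
      c~x : c ~ x

  isIso⇒Hexagon : ∀ {H x a y b z c} → IsSubgraph G H →
    IsIso (Cycle 6) H (lookup (x ∷ a ∷ y ∷ b ∷ z ∷ c ∷ [])) → Hexagon x a y b z c
  isIso⇒Hexagon {H} {x} {a} {y} {b} {z} {c} (edges , _) (inj , _ , _ , adj) = hexagon
    (Unique.tabulate⁺ inj)
    (edge 0F 1F (from-yes (1F ∈? N (Cycle 6) 0F)))
    (edge 1F 2F (from-yes (2F ∈? N (Cycle 6) 1F)))
    (edge 2F 3F (from-yes (3F ∈? N (Cycle 6) 2F)))
    (edge 3F 4F (from-yes (4F ∈? N (Cycle 6) 3F)))
    (edge 4F 5F (from-yes (5F ∈? N (Cycle 6) 4F)))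
    (edge 5F 0F (from-yes (0F ∈? N (Cycle 6) 5F)))
    where
    vs = x ∷ a ∷ y ∷ b ∷ z ∷ c ∷ []
    edge : ∀ i j → j ∈ N (Cycle 6) i → lookup vs i ~ lookup vs j
    edge i j j∈ = edges _ (proj₁ (adj i j) j∈)

  infixr 5 _⊳_

  _⊳_ : ∀ {x : Fin n} {xs} → x ∉ₗ xs → Unique xs → Unique (x ∷ xs)
  x∉ ⊳ u = ¬Any⇒All¬ _ x∉ ∷ u

  ClosedWalk₈ : (Fin 8 → Fin n) → Set
  ClosedWalk₈ f = f 0F ~ f 1F × f 1F ~ f 2F × f 2F ~ f 3F × f 3F ~ f 4F
                × f 4F ~ f 5F × f 5F ~ f 6F × f 6F ~ f 7F × f 7F ~ f 0F


  -- The vertices are listed in the order in which a proof finds them;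
  -- σ says in which order the cycle visits them.
  no-octagon : (xs : List (Fin n)) → Unique xs → (σ : Vec (Fin (length xs)) 8) →
    {True (injective? (lookup σ))} → ¬ ClosedWalk₈ (List.lookup xs ∘ lookup σ)
  no-octagon xs u σ {σ-inj} (e₀ , e₁ , e₂ , e₃ , e₄ , e₅ , e₆ , e₇) =
    free (image (Cycle 8) G f , image-isCopy (Cycle 8) G f (λ eq → toWitness σ-inj (lookup-injective u eq)) hom)
    where
    f : Fin 8 → Fin n
    f = List.lookup xs ∘ lookup σ
    next : ∀ i → ∃ λ j → Next 8 i j × f i ~ f j
    next 0F = 1F , refl , e₀
    next 1F = 2F , refl , e₁
    next 2F = 3F , refl , e₂
    next 3F = 4F , refl , e₃
    next 4F = 5F , refl , e₄
    next 5F = 6F , refl , e₅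
    next 6F = 7F , refl , e₆
    next 7F = 0F , refl , e₇
    next-~ : ∀ i j → Next 8 i j → f i ~ f j
    next-~ i j i→j with next i
    ... | j′ , i→j′ , e = subst (λ v → f i ~ f v) (Fin.toℕ-injective (trans i→j′ (sym i→j))) e
    hom : Homomorphism (Cycle 8) G f
    hom i j j∈ = [ next-~ i j , ~-sym ∘ next-~ j i ]′ (∈-toSubset⁻ (CycleAdj 8 i) (cycleAdj? 8 i) j∈)

  -- Linear bounds for the edges near a vertex.

  -- The edges that meet N(v), as a bipartite graph with an end in N(v) on the left.
  Star : Fin n → Fin n → Fin n → Set
  Star v p q = v ~ p × p ~ q

  star? : ∀ v → Decidable₂ (Star v)
  star? v p q = (v ~? p) ×-dec (p ~? q)

  module _ (v : Fin n) where

    private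
      -- Edges back to `v` are left out because the paths must avoid `v`.
      E : Fin n → Fin n → Set
      E p q = Star v p q × q ≢ v
      e? : Decidable₂ E
      e? p q = star? v p q ×-dec ¬? (q Fin.≟ v)
      p₁ = peel? 8 e?
      p₂ = peel? 8 p₁
      p₃ = peel? 8 p₂

      -- An edge surviving three rounds starts a path u₀ q₀ u₁ q₁ u₂ q₂ u₃ with both ends in N(v),
      -- which `v` closes to an 8-cycle. The last extension avoids seven vertices, so degree bound 8
      -- is just large enough.
      no-edge : ∀ {u₀ q₀} → ¬ Peel 8 p₂ u₀ q₀
      no-edge {u₀} {q₀} e₀ with Peel⊆ 8 e? (Peel⊆ 8 p₁ (Peel⊆ 8 p₂ e₀))
                              | extend 8 p₂ e₀ (q₀ ∷ u₀ ∷ v ∷ []) (ℕ.m≤m+n 4 4)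
      ... | (v~u₀ , u₀~q₀) , q₀≢v | u₁ , q₁ , d₁ , e₁ , u₁∉ , q₁∉
        with Peel⊆ 8 e? (Peel⊆ 8 p₁ d₁) | Peel⊆ 8 e? (Peel⊆ 8 p₁ e₁)
           | extend 8 p₁ e₁ (q₁ ∷ u₁ ∷ q₀ ∷ u₀ ∷ v ∷ []) (ℕ.m≤m+n 6 2)
      ... | (_ , u₁~q₀) , _ | (_ , u₁~q₁) , _ | u₂ , q₂ , d₂ , e₂ , u₂∉ , q₂∉
        with Peel⊆ 8 e? d₂ | Peel⊆ 8 e? e₂
           | extend 8 e? e₂ (q₂ ∷ u₂ ∷ q₁ ∷ u₁ ∷ q₀ ∷ u₀ ∷ v ∷ []) (ℕ.m≤m+n 8 0)
      ... | (_ , u₂~q₁) , _ | (_ , u₂~q₂) , _ | u₃ , _ , ((v~u₃ , u₃~q₂) , _) , _ , u₃∉ , _ =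
        no-octagon (u₃ ∷ q₂ ∷ u₂ ∷ q₁ ∷ u₁ ∷ q₀ ∷ u₀ ∷ v ∷ [])
          (u₃∉ ⊳ q₂∉ ⊳ u₂∉ ⊳ q₁∉ ⊳ u₁∉ ⊳ ((~⇒≢ u₀~q₀ ∘ sym) ∉∷ q₀≢v ∉∷ ∉[])
            ⊳ ((~⇒≢ v~u₀ ∘ sym) ∉∷ ∉[]) ⊳ ∉[] ⊳ [])
          (7F ∷ 6F ∷ 5F ∷ 4F ∷ 3F ∷ 2F ∷ 1F ∷ 0F ∷ [])
          (v~u₀ , u₀~q₀ , ~-sym u₁~q₀ , u₁~q₁ , ~-sym u₂~q₁ , u₂~q₂ , ~-sym u₃~q₂ , ~-sym v~u₃)

    -- Each of the three rounds deletes at most 16n edges and nothing is left; edges ending in `v`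
    -- add at most n.
    size-star : size (star? v) ≤ n * 49
    size-star = begin
      size (star? v)                                            ≤⟨ size-∪ (star? v) e? to-v? split ⟩
      size e? + size to-v?                                      ≤⟨ +-mono-≤ size-e to-v ⟩
      n * 48 + n * 1                                            ≡⟨ sym (ℕ.*-distribˡ-+ n 48 1) ⟩
      n * 49                                                    ∎
      where
      open ℕ.≤-Reasoning
      To-v : Fin n → Fin n → Set
      To-v p q = q ≡ v
      to-v? : Decidable₂ To-v
      to-v? p q = q Fin.≟ v
      split : ∀ {p q} → Star v p q → E p q ⊎ To-v p q
      split {p} {q} s with q Fin.≟ v
      ... | yes eq = inj₂ eq
      ... | no ≢v  = inj₁ (s , ≢v)
      to-v : size to-v? ≤ n * 1
      to-v = ≤-trans (∑-≤ (allFin n) (λ {p} _ → #-≤-list (to-v? p) (v ∷ []) (λ { refl → here refl })))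
        (≤-reflexive (cong (_* 1) (length-allFin n)))
      rounds : ∀ m → 0 + (m * 8 + m * 8) + (m * 8 + m * 8) + (m * 8 + m * 8) ≡ m * 48
      rounds = solve-∀
      size-e : size e? ≤ n * 48
      size-e = begin
        size e?                          ≤⟨ size-peel 8 e? ⟩
        size p₁ + r                      ≤⟨ ℕ.+-monoˡ-≤ r (size-peel 8 p₁) ⟩
        size p₂ + r + r                  ≤⟨ ℕ.+-monoˡ-≤ r (ℕ.+-monoˡ-≤ r (size-peel 8 p₂)) ⟩
        size p₃ + r + r + r              ≡⟨ cong (λ s → s + r + r + r) (size-empty p₃ no-edge) ⟩
        0 + r + r + r                    ≡⟨ rounds n ⟩
        n * 48                           ∎
        where
        r = n * 8 + n * 8

  module _ (v : Fin n) where

    Walk₂ : Fin n → Set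
    Walk₂ w = w ≢ v × ∃ λ u → v ~ u × u ~ w

    -- In a 6-cycle starting at `v`, the third and fourth vertices form such an edge.
    SecondStar : Fin n → Fin n → Set
    SecondStar w x = Walk₂ w × w ~ x

    secondStar? : Decidable₂ SecondStar
    secondStar? w x = (¬? (w Fin.≟ v) ×-dec any? (λ u → (v ~? u) ×-dec (u ~? w))) ×-dec (w ~? x)

    private
      -- Junk if w has no neighbour in N v.
      parent : Fin n → Fin n
      parent w with any? (λ u → (v ~? u) ×-dec (u ~? w))
      ... | yes (u , _) = u
      ... | no _        = w

      HasParent : Fin n → Set
      HasParent w = v ~ parent w × parent w ~ w

      hasParent : ∀ {w u} → v ~ u → u ~ w → HasParent w
      hasParent {w} v~u u~w with any? (λ u → (v ~? u) ×-dec (u ~? w))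
      ... | yes (_ , p) = p
      ... | no ¬p       = contradiction (_ , v~u , u~w) ¬p

      Outer : Fin n → Set
      Outer w = ¬ v ~ w

      -- The edges with no end in N(v). Parents lie in N(v), so they are distinct from all vertices
      -- of a path of such edges.
      E : Fin n → Fin n → Set
      E w x = (HasParent w × w ≢ v × Outer w) × Outer x × w ~ x

      e? : Decidable₂ E
      e? w x = (((v ~? parent w) ×-dec (parent w ~? w)) ×-dec ¬? (w Fin.≟ v) ×-dec ¬? (v ~? w))
        ×-dec ¬? (v ~? x) ×-dec (w ~? x)

      E⇒~ : ∀ {w x} → E w x → w ~ x
      E⇒~ (_ , _ , w~x) = w~x

      E⇒x≢v : ∀ {w x} → E w x → x ≢ v
      E⇒x≢v ((_ , _ , ¬v~w) , _ , w~x) refl = ¬v~w (~-sym w~x)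

      inner∉ : ∀ {u ws} → v ~ u → All Outer ws → u ∉ₗ ws
      inner∉ v~u outer u∈ = All.lookup outer u∈ v~u

      -- Otherwise `v`, the two parents and the five vertices of the path form an 8-cycle.
      4-path⇒same-parent : ∀ {w₀ x w₁ y w₂} → Unique (w₂ ∷ y ∷ w₁ ∷ x ∷ w₀ ∷ []) →
        E w₀ x → E w₁ x → E w₁ y → E w₂ y → parent w₀ ≡ parent w₂
      4-path⇒same-parent {w₀} {x} {w₁} {y} {w₂} u
        e₀@(((v~u₀ , u₀~w₀) , w₀≢v , ow₀) , ox , w₀~x) ((_ , w₁≢v , ow₁) , _ , w₁~x)
        e₂@(_ , oy , w₁~y) (((v~u₂ , u₂~w₂) , w₂≢v , ow₂) , _ , w₂~y)
        with parent w₀ Fin.≟ parent w₂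
      ... | yes eq = eq
      ... | no ≢   = contradiction
        (v~u₀ , u₀~w₀ , w₀~x , ~-sym w₁~x , w₁~y , ~-sym w₂~y , ~-sym u₂~w₂ , ~-sym v~u₂)
        (no-octagon (parent w₀ ∷ parent w₂ ∷ v ∷ w₂ ∷ y ∷ w₁ ∷ x ∷ w₀ ∷ [])
          ((≢ ∉∷ (~⇒≢ v~u₀ ∘ sym) ∉∷ inner∉ v~u₀ outer)
            ⊳ ((~⇒≢ v~u₂ ∘ sym) ∉∷ inner∉ v~u₂ outer)
            ⊳ ((w₂≢v ∘ sym) ∉∷ (E⇒x≢v e₂ ∘ sym) ∉∷ (w₁≢v ∘ sym) ∉∷ (E⇒x≢v e₀ ∘ sym) ∉∷ (w₀≢v ∘ sym) ∉∷ ∉[])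
            ⊳ u)
          (2F ∷ 0F ∷ 7F ∷ 6F ∷ 5F ∷ 4F ∷ 3F ∷ 1F ∷ []))
        where
        outer : All Outer (w₂ ∷ y ∷ w₁ ∷ x ∷ w₀ ∷ [])
        outer = ow₂ ∷ oy ∷ ow₁ ∷ ox ∷ ow₀ ∷ []

      p₁ = peel? 8 e?
      p₂ = peel? 8 p₁
      p₃ = peel? 8 p₂
      p₄ = peel? 8 p₃

      -- From `x` there is a common continuation x w₁ y w₂, so `w` and `w′` both start 4-paths
      -- ending in w₂ and share its parent.
      same-parent : ∀ {w w′ x} → Peel 8 p₁ w x → E w′ x → w′ ≢ w → parent w ≡ parent w′
      same-parent {w} {w′} {x} d e′ w′≢w with Peel⊆ 8 e? (Peel⊆ 8 p₁ d)
                                            | extend 8 p₁ d (x ∷ w′ ∷ w ∷ []) (ℕ.m≤m+n 4 4)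
      ... | e | w₁ , y , d₁ , d₁′ , w₁∉ , y∉
        with Peel⊆ 8 e? d₁ | Peel⊆ 8 e? d₁′
           | extend 8 e? d₁′ (y ∷ w₁ ∷ x ∷ w′ ∷ w ∷ []) (ℕ.m≤m+n 6 2)
      ... | e₁ | e₁′ | w₂ , _ , e₂ , _ , w₂∉ , _ =
        trans (4-path⇒same-parent (subfamily u (0F ∷ 1F ∷ 2F ∷ 3F ∷ 5F ∷ [])) e e₁ e₁′ e₂)
          (sym (4-path⇒same-parent (subfamily u (0F ∷ 1F ∷ 2F ∷ 3F ∷ 4F ∷ [])) e′ e₁ e₁′ e₂))
        where
        u : Unique (w₂ ∷ y ∷ w₁ ∷ x ∷ w′ ∷ w ∷ [])
        u = w₂∉ ⊳ y∉ ⊳ w₁∉ ⊳ ((~⇒≢ (E⇒~ e′) ∘ sym) ∉∷ (~⇒≢ (E⇒~ e) ∘ sym) ∉∷ ∉[]) ⊳ (w′≢w ∉∷ ∉[]) ⊳ ∉[] ⊳ []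

      -- All left vertices of a path in the peeled graph have the same
      -- parent, so a path of length 6 between them closes through it.
      no-edge : ∀ {w₀ x} → ¬ Peel 8 p₃ w₀ x
      no-edge {w₀} {x} d₀ with extend 8 p₃ d₀ (x ∷ w₀ ∷ []) (ℕ.m≤m+n 3 5)
      ... | w₁ , z , d₁ , d₁′ , w₁∉ , z∉
        with extend 8 p₂ d₁′ (z ∷ w₁ ∷ x ∷ w₀ ∷ []) (ℕ.m≤m+n 5 3)
      ... | w₂ , y , d₂ , d₂′ , w₂∉ , y∉
        with extend 8 p₁ d₂′ (y ∷ w₂ ∷ z ∷ w₁ ∷ x ∷ w₀ ∷ []) (ℕ.m≤m+n 7 1)
      ... | w₃ , _ , d₃ , _ , w₃∉ , _ = contradiction
        ( u₀~w₃ , E⇒~ e₃ , ~-sym (E⇒~ e₂′) , E⇒~ e₂ , ~-sym (E⇒~ e₁′) , E⇒~ e₁ , ~-sym (E⇒~ e₀) , ~-sym u₀~w₀)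
        (no-octagon (parent w₀ ∷ w₃ ∷ y ∷ w₂ ∷ z ∷ w₁ ∷ x ∷ w₀ ∷ [])
          (inner∉ v~u₀ (outerˡ e₃ ∷ outerʳ e₂′ ∷ outerˡ e₂ ∷ outerʳ e₁′ ∷ outerˡ e₁ ∷ outerʳ e₀ ∷ outerˡ e₀ ∷ [])
            ⊳ w₃∉ ⊳ y∉ ⊳ w₂∉ ⊳ z∉ ⊳ w₁∉ ⊳ ((~⇒≢ (E⇒~ e₀) ∘ sym) ∉∷ ∉[]) ⊳ ∉[] ⊳ [])
          (0F ∷ 1F ∷ 2F ∷ 3F ∷ 4F ∷ 5F ∷ 6F ∷ 7F ∷ []))
        where
        outerˡ : ∀ {w x} → E w x → Outer w
        outerˡ ((_ , _ , o) , _) = o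
        outerʳ : ∀ {w x} → E w x → Outer x
        outerʳ (_ , o , _) = o
        e₀ = Peel⊆ 8 e? (Peel⊆ 8 p₁ (Peel⊆ 8 p₂ (Peel⊆ 8 p₃ d₀)))
        e₁ = Peel⊆ 8 e? (Peel⊆ 8 p₁ (Peel⊆ 8 p₂ d₁))
        e₁′ = Peel⊆ 8 e? (Peel⊆ 8 p₁ (Peel⊆ 8 p₂ d₁′))
        e₂ = Peel⊆ 8 e? (Peel⊆ 8 p₁ d₂)
        e₂′ = Peel⊆ 8 e? (Peel⊆ 8 p₁ d₂′)
        e₃ = Peel⊆ 8 e? d₃
        v~u₀ : v ~ parent w₀
        v~u₀ = proj₁ (proj₁ (proj₁ e₀))
        u₀~w₀ : parent w₀ ~ w₀
        u₀~w₀ = proj₂ (proj₁ (proj₁ e₀))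
        parent-eq : parent w₀ ≡ parent w₃
        parent-eq = trans (same-parent (Peel⊆ 8 p₂ (Peel⊆ 8 p₃ d₀)) e₁ (λ eq → w₁∉ (there (here eq))))
          (trans (same-parent (Peel⊆ 8 p₂ d₁′) e₂ (λ eq → w₂∉ (there (here eq))))
            (same-parent d₂′ e₃ (λ eq → w₃∉ (there (here eq)))))
        u₀~w₃ : parent w₀ ~ w₃
        u₀~w₃ = subst (_~ w₃) (sym parent-eq) (proj₂ (proj₁ (proj₁ e₃)))

    -- Edges with the left or the right end in N(v) are bounded by `size-star`, 49n each. The
    -- remaining ones vanish after four rounds that delete at most 16n each.
    size-secondStar : size secondStar? ≤ n * 162
    size-secondStar = begin
      size secondStar?                                                  ≤⟨ size-∪ secondStar? s? rest? split ⟩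
      size s? + size rest?                                              ≤⟨ ℕ.+-monoʳ-≤ (size s?) (size-∪ rest? (flip s?) e? id) ⟩
      size s? + (size (flip s?) + size e?)                              ≡⟨ cong (λ m → size s? + (m + size e?)) (sym (size-flip s?)) ⟩
      size s? + (size s? + size e?)                                     ≤⟨ +-mono-≤ (size-star v) (+-mono-≤ (size-star v) size-e) ⟩
      n * 49 + (n * 49 + n * 64)                                        ≡⟨ total n ⟩
      n * 162                                                           ∎
      where
      open ℕ.≤-Reasoning
      s? : Decidable₂ (Star v)
      s? = star? v
      Rest : Fin n → Fin n → Set
      Rest w x = Star v x w ⊎ E w x
      rest? : Decidable₂ Rest
      rest? w x = s? x w ⊎-dec e? w x
      split : ∀ {w x} → SecondStar w x → Star v w x ⊎ Rest w x
      split {w} {x} ((w≢v , _ , v~u , u~w) , w~x) with v ~? w | v ~? x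
      ... | yes v~w | _       = inj₁ (v~w , w~x)
      ... | no _    | yes v~x = inj₂ (inj₁ (v~x , ~-sym w~x))
      ... | no ¬v~w | no ¬v~x = inj₂ (inj₂ ((hasParent v~u u~w , w≢v , ¬v~w) , ¬v~x , w~x))
      total : ∀ m → m * 49 + (m * 49 + m * 64) ≡ m * 162
      total = solve-∀
      rounds : ∀ m → 0 + (m * 8 + m * 8) + (m * 8 + m * 8) + (m * 8 + m * 8) + (m * 8 + m * 8) ≡ m * 64
      rounds = solve-∀
      size-e : size e? ≤ n * 64
      size-e = begin
        size e?                          ≤⟨ size-peel 8 e? ⟩
        size p₁ + r                      ≤⟨ ℕ.+-monoˡ-≤ r (size-peel 8 p₁) ⟩
        size p₂ + r + r                  ≤⟨ ℕ.+-monoˡ-≤ r (ℕ.+-monoˡ-≤ r (size-peel 8 p₂)) ⟩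
        size p₃ + r + r + r              ≤⟨ ℕ.+-monoˡ-≤ r (ℕ.+-monoˡ-≤ r (ℕ.+-monoˡ-≤ r (size-peel 8 p₃))) ⟩
        size p₄ + r + r + r + r          ≡⟨ cong (λ s → s + r + r + r + r) (size-empty p₄ no-edge) ⟩
        0 + r + r + r + r                ≡⟨ rounds n ⟩
        n * 64                           ∎
        where
        r = n * 8 + n * 8

  -- Sums of degrees and of their squares.

  degree : Fin n → ℕ
  degree u = #[ (λ v → u ~? v) ]

  -- Double counting of the walks v p q: by the middle vertex on the left, by the first vertex and
  -- `size-star` on the right.
  ∑-degree²-≤ : ∑ (allFin n) (λ p → degree p * degree p) ≤ n * (n * 49)
  ∑-degree²-≤ = begin
    ∑ (allFin n) (λ p → degree p * degree p)                          ≤⟨ ∑-mono (allFin n) (λ {p} _ → row p) ⟩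
    ∑ (allFin n) (λ p → ∑ (allFin n) (λ v → #[ star? v p ]))          ≡⟨ sym (∑-comm (allFin n) (allFin n) (λ v p → #[ star? v p ])) ⟩
    ∑ (allFin n) (λ v → size (star? v))                               ≤⟨ ∑-≤ (allFin n) (λ {v} _ → size-star v) ⟩
    length (allFin n) * (n * 49)                                      ≡⟨ cong (_* (n * 49)) (length-allFin n) ⟩
    n * (n * 49)                                                      ∎
    where
    open ℕ.≤-Reasoning
    row : ∀ p → degree p * degree p ≤ ∑ (allFin n) (λ v → #[ star? v p ])
    row p = begin
      degree p * degree p                               ≡⟨ sym (∑-const (select (p ~?_)) (degree p)) ⟩
      ∑ (select (p ~?_)) (λ _ → degree p)               ≤⟨ ∑-mono (select (p ~?_)) (λ {v} v∈ →
                                                             #-mono (p ~?_) (star? v p) (~-sym (∈-select⁻ (p ~?_) v∈) ,_)) ⟩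
      ∑ (select (p ~?_)) (λ v → #[ star? v p ])         ≤⟨ ∑-filter-≤ (p ~?_) (allFin n) _ ⟩
      ∑ (allFin n) (λ v → #[ star? v p ])               ∎

  -- Summing t d ≤ t² + d² over the degrees d. Since `t` is free, the degree sum is o(n²).
  *-∑-degree-≤ : ∀ t → t * ∑ (allFin n) degree ≤ n * (t * t) + n * (n * 49)
  *-∑-degree-≤ t = begin
    t * ∑ (allFin n) degree                                                    ≡⟨ *-distribˡ-∑ t (allFin n) degree ⟩
    ∑ (allFin n) (λ p → t * degree p)                                          ≤⟨ ∑-mono (allFin n) (λ {p} _ → split (degree p)) ⟩
    ∑ (allFin n) (λ p → t * t + degree p * degree p)                           ≡⟨ ∑-distrib-+ (allFin n) (λ _ → t * t) _ ⟩
    ∑ (allFin n) (λ _ → t * t) + ∑ (allFin n) (λ p → degree p * degree p)      ≤⟨ +-mono-≤ (≤-reflexive constant) ∑-degree²-≤ ⟩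
    n * (t * t) + n * (n * 49)                                                 ∎
    where
    open ℕ.≤-Reasoning
    constant : ∑ (allFin n) (λ _ → t * t) ≡ n * (t * t)
    constant = trans (∑-const (allFin n) (t * t)) (cong (_* (t * t)) (length-allFin n))
    split : ∀ d → t * d ≤ t * t + d * d
    split d with ℕ.≤-total t d
    ... | inj₁ t≤d = ≤-trans (ℕ.*-monoˡ-≤ d t≤d) (ℕ.m≤n+m _ (t * t))
    ... | inj₂ d≤t = ≤-trans (ℕ.*-monoʳ-≤ t d≤t) (ℕ.m≤m+n _ (d * d))

  -- Fat pairs and fat triangles.

  common? : ∀ x z → Decidable (λ w → x ~ w × z ~ w)
  common? x z w = (x ~? w) ×-dec (z ~? w)

  codegree : Fin n → Fin n → ℕ
  codegree x z = #[ common? x z ]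

  codegree-comm : ∀ x z → codegree x z ≡ codegree z x
  codegree-comm x z = ℕ.≤-antisym (#-mono (common? x z) (common? z x) swap) (#-mono (common? z x) (common? x z) swap)

  Fat : Fin n → Fin n → Set
  Fat x z = 8 < codegree x z

  fat? : ∀ x z → Dec (Fat x z)
  fat? x z = 8 ℕ.<? codegree x z

  fat-sym : ∀ {x z} → Fat x z → Fat z x
  fat-sym {x} {z} = subst (8 <_) (codegree-comm x z)

  midpoint : ∀ {x z} → Fat x z → (avoid : List (Fin n)) → length avoid ≤ 8 →
    ∃ λ w → (x ~ w × z ~ w) × w ∉ₗ avoid
  midpoint {x} {z} fat avoid short = fresh-select (common? x z) avoid (ℕ.≤-<-trans short fat)

  -- Replacing each fat pair by a path through a fresh midpoint gives an 8-cycle.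
  no-fat-square : ∀ {x₁ x₂ x₃ x₄} → Unique (x₁ ∷ x₂ ∷ x₃ ∷ x₄ ∷ []) →
    Fat x₁ x₂ → Fat x₂ x₃ → Fat x₃ x₄ → ¬ Fat x₄ x₁
  no-fat-square {x₁} {x₂} {x₃} {x₄} u f₁ f₂ f₃ f₄
    with midpoint f₁ (x₁ ∷ x₂ ∷ x₃ ∷ x₄ ∷ []) (ℕ.m≤m+n 4 4)
  ... | m₁ , (a₁ , b₁) , m₁∉ with midpoint f₂ (m₁ ∷ x₁ ∷ x₂ ∷ x₃ ∷ x₄ ∷ []) (ℕ.m≤m+n 5 3)
  ... | m₂ , (a₂ , b₂) , m₂∉ with midpoint f₃ (m₂ ∷ m₁ ∷ x₁ ∷ x₂ ∷ x₃ ∷ x₄ ∷ []) (ℕ.m≤m+n 6 2)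
  ... | m₃ , (a₃ , b₃) , m₃∉ with midpoint f₄ (m₃ ∷ m₂ ∷ m₁ ∷ x₁ ∷ x₂ ∷ x₃ ∷ x₄ ∷ []) (ℕ.m≤m+n 7 1)
  ... | m₄ , (a₄ , b₄) , m₄∉ =
    no-octagon (m₄ ∷ m₃ ∷ m₂ ∷ m₁ ∷ x₁ ∷ x₂ ∷ x₃ ∷ x₄ ∷ []) (m₄∉ ⊳ m₃∉ ⊳ m₂∉ ⊳ m₁∉ ⊳ u)
      (4F ∷ 3F ∷ 5F ∷ 2F ∷ 6F ∷ 1F ∷ 7F ∷ 0F ∷ [])
      (a₁ , ~-sym b₁ , a₂ , ~-sym b₂ , a₃ , ~-sym b₃ , a₄ , ~-sym b₄)

  -- With fresh midpoints a and b, the paths p u a v q and p u′ b v′ q together form an 8-cycle.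
  no-two-links : ∀ {p q u v u′ v′} → Unique (p ∷ q ∷ u ∷ v ∷ u′ ∷ v′ ∷ []) →
    p ~ u → q ~ v → Fat u v → p ~ u′ → q ~ v′ → ¬ Fat u′ v′
  no-two-links {p} {q} {u} {v} {u′} {v′} uq p~u q~v f p~u′ q~v′ f′
    with midpoint f (p ∷ q ∷ u ∷ v ∷ u′ ∷ v′ ∷ []) (ℕ.m≤m+n 6 2)
  ... | a , (u~a , v~a) , a∉ with midpoint f′ (a ∷ p ∷ q ∷ u ∷ v ∷ u′ ∷ v′ ∷ []) (ℕ.m≤m+n 7 1)
  ... | b , (u′~b , v′~b) , b∉ =
    no-octagon (b ∷ a ∷ p ∷ q ∷ u ∷ v ∷ u′ ∷ v′ ∷ []) (b∉ ⊳ a∉ ⊳ uq)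
      (2F ∷ 4F ∷ 1F ∷ 5F ∷ 3F ∷ 7F ∷ 0F ∷ 6F ∷ [])
      (p~u , u~a , ~-sym v~a , ~-sym q~v , q~v′ , v′~b , ~-sym u′~b , ~-sym p~u′)

  -- The adjacent midpoints are z and c. With new midpoints p of {b, c} and q of {z, x}, the 8-cycle
  -- is b p c z q x a y.
  adjacent-midpoints-not-fat : ∀ {x a y b z c} → Hexagon x a y b z c → Fat b c → ¬ Fat z x
  adjacent-midpoints-not-fat {x} {a} {y} {b} {z} {c} (hexagon u x~a a~y y~b b~z z~c c~x) f f′
    with midpoint f (x ∷ a ∷ y ∷ b ∷ z ∷ c ∷ []) (ℕ.m≤m+n 6 2)
  ... | p , (b~p , c~p) , p∉ with midpoint f′ (p ∷ x ∷ a ∷ y ∷ b ∷ z ∷ c ∷ []) (ℕ.m≤m+n 7 1)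
  ... | q , (z~q , x~q) , q∉ =
    no-octagon (q ∷ p ∷ x ∷ a ∷ y ∷ b ∷ z ∷ c ∷ []) (q∉ ⊳ p∉ ⊳ u)
      (5F ∷ 1F ∷ 7F ∷ 6F ∷ 0F ∷ 2F ∷ 3F ∷ 4F ∷ [])
      (b~p , ~-sym c~p , ~-sym z~c , z~q , ~-sym x~q , x~a , a~y , y~b)

  -- {x, y, z} is a fat triangle that closes the path a y b to a 6-cycle,
  -- up to the common neighbour of x and z.
  Span : Fin n → Fin n → Fin n → Fin n → Fin n → Set
  Span a b x y z = (x ≢ y × y ≢ z × x ≢ z × a ≢ b × a ≢ z × b ≢ x)
    × (a ~ x × a ~ y × b ~ y × b ~ z) × (Fat x y × Fat y z × Fat x z)

  span? : ∀ a b x y z → Dec (Span a b x y z)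
  span? a b x y z =
    (¬? (x Fin.≟ y) ×-dec ¬? (y Fin.≟ z) ×-dec ¬? (x Fin.≟ z)
      ×-dec ¬? (a Fin.≟ b) ×-dec ¬? (a Fin.≟ z) ×-dec ¬? (b Fin.≟ x))
    ×-dec ((a ~? x) ×-dec (a ~? y) ×-dec (b ~? y) ×-dec (b ~? z))
    ×-dec (fat? x y ×-dec fat? y z ×-dec fat? x z)

  module _ {a b x′ y′ z′ : Fin n} (T′ : Span a b x′ y′ z′) where

    private
      others : List (Fin n)
      others = x′ ∷ y′ ∷ z′ ∷ []

      -- Every pair of {x, y, z} carries a path of length 4 between a and b,
      -- and so does the pair {x′, y′}; two disjoint ones close an 8-cycle.
      one-inside : ∀ {u v} → a ~ u → b ~ v → Fat u v → u ≢ v → v ≢ a → u ≢ b → u ∉ₗ others → v ∈ₗ others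
      one-inside {u} {v} a~u b~v f u≢v v≢a u≢b u∉
        with member? Fin._≟_ v others
      ... | yes v∈ = v∈
      ... | no v∉  =
        let (x′≢y′ , _ , _ , a≢b , _ , b≢x′) , (a~x′ , a~y′ , b~y′ , _) , (f′ , _) = T′ in
        contradiction f′ (no-two-links
          ( (a≢b ∉∷ ~⇒≢ a~u ∉∷ (v≢a ∘ sym) ∉∷ ~⇒≢ a~x′ ∉∷ ~⇒≢ a~y′ ∉∷ ∉[])
          ⊳ ((u≢b ∘ sym) ∉∷ ~⇒≢ b~v ∉∷ b≢x′ ∉∷ ~⇒≢ b~y′ ∉∷ ∉[])
          ⊳ (u≢v ∉∷ (λ eq → u∉ (here eq)) ∉∷ (λ eq → u∉ (there (here eq))) ∉∷ ∉[])
          ⊳ ((λ eq → v∉ (here eq)) ∉∷ (λ eq → v∉ (there (here eq))) ∉∷ ∉[])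
          ⊳ (x′≢y′ ∉∷ ∉[]) ⊳ ∉[] ⊳ [])
          a~u b~v f a~x′ b~y′)

      third : ∀ {u v} → u ∈ₗ others → v ∈ₗ others → u ≢ v →
        ∃ λ t → t ∈ₗ others × t ≢ u × t ≢ v × Fat u t × Fat v t
      third = go T′
        where
        go : Span a b x′ y′ z′ → ∀ {u v} → u ∈ₗ others → v ∈ₗ others → u ≢ v →
          ∃ λ t → t ∈ₗ others × t ≢ u × t ≢ v × Fat u t × Fat v t
        go ((xy , yz , xz , _) , _ , (fxy , fyz , fxz)) = λ
          { (here refl) (here refl) u≢v → contradiction refl u≢v
          ; (here refl) (there (here refl)) _ → z′ , there (there (here refl)) , xz ∘ sym , yz ∘ sym , fxz , fyz
          ; (here refl) (there (there (here refl))) _ → y′ , there (here refl) , xy ∘ sym , yz , fxy , fat-sym fyz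
          ; (there (here refl)) (here refl) _ → z′ , there (there (here refl)) , yz ∘ sym , xz ∘ sym , fyz , fxz
          ; (there (here refl)) (there (here refl)) u≢v → contradiction refl u≢v
          ; (there (here refl)) (there (there (here refl))) _ → x′ , here refl , xy , xz , fat-sym fxy , fat-sym fxz
          ; (there (there (here refl))) (here refl) _ → y′ , there (here refl) , yz , xy ∘ sym , fat-sym fyz , fxy
          ; (there (there (here refl))) (there (here refl)) _ → x′ , here refl , xz , xy , fat-sym fxz , fat-sym fxy
          ; (there (there (here refl))) (there (there (here refl))) u≢v → contradiction refl u≢v
          }

      -- If `s` were outside, it would form a fat 4-cycle s u t v with the third vertex t of the
      -- triangle.
      none-outside : ∀ {s u v} → u ∈ₗ others → v ∈ₗ others → u ≢ v → s ≢ u → s ≢ v →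
        Fat s u → Fat s v → s ∈ₗ others
      none-outside {s} {u} {v} u∈ v∈ u≢v s≢u s≢v fu fv with member? Fin._≟_ s others | third u∈ v∈ u≢v
      ... | yes s∈ | _ = s∈
      ... | no s∉  | t , t∈ , t≢u , t≢v , gu , gv = contradiction (fat-sym fv) (no-fat-square
        ((s≢u ∉∷ (λ { refl → s∉ t∈ }) ∉∷ s≢v ∉∷ ∉[]) ⊳ ((t≢u ∘ sym) ∉∷ u≢v ∉∷ ∉[]) ⊳ (t≢v ∉∷ ∉[]) ⊳ ∉[] ⊳ [])
        fu gu (fat-sym gv))

    -- By `one-inside` at most one of x, y, z lies outside the other triangle, and `none-outside`
    -- excludes a single one.
    span-⊆ : ∀ {x y z} → Span a b x y z → x ∈ₗ others × y ∈ₗ others × z ∈ₗ others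
    span-⊆ {x} {y} {z} ((xy , yz , xz , ab , az , bx) , (a~x , a~y , b~y , b~z) , (fxy , fyz , fxz))
      with member? Fin._≟_ x others | member? Fin._≟_ y others
    ... | yes x∈ | yes y∈ =
      x∈ , y∈ , none-outside x∈ y∈ xy (xz ∘ sym) (yz ∘ sym) (fat-sym fxz) (fat-sym fyz)
    ... | yes x∈ | no y∉ =
      x∈ , none-outside x∈ z∈ xz (xy ∘ sym) yz (fat-sym fxy) fyz , z∈
      where
      z∈ = one-inside a~y b~z fyz yz (az ∘ sym) (~⇒≢ b~y ∘ sym) y∉
    ... | no x∉ | _ =
      none-outside y∈ z∈ yz xy xz fxy fxz , y∈ , z∈
      where
      y∈ = one-inside a~x b~y fxy xy (~⇒≢ a~y ∘ sym) (bx ∘ sym) x∉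
      z∈ = one-inside a~x b~z fxz xz (az ∘ sym) (bx ∘ sym) x∉

  -- Cycles with two opposite midpoints of thin pairs.

  Code : PreSubgraph n → Vec (Fin n) 6 → Set
  Code H t = IsSubgraph G H × IsIso (Cycle 6) H (lookup t)

  -- Empty for a fat pair, so that the length is at most 8 for every pair.
  thinCommon : Fin n → Fin n → List (Fin n)
  thinCommon x z with fat? x z
  ... | yes _ = []
  ... | no _  = select (common? x z)

  length-thinCommon : ∀ x z → length (thinCommon x z) ≤ 8
  length-thinCommon x z with fat? x z
  ... | yes _   = z≤n
  ... | no thin = ℕ.≮⇒≥ thin

  ∈-thinCommon : ∀ {x z w} → ¬ Fat x z → x ~ w → z ~ w → w ∈ₗ thinCommon x z
  ∈-thinCommon {x} {z} thin x~w z~w with fat? x z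
  ... | yes fat = contradiction fat thin
  ... | no _    = ∈-select⁺ (common? x z) (x~w , z~w)

  -- A cycle x a y b z c with {x, y} and {b, c} thin is determined by the
  -- edges xc and yb and by one of at most 8 choices for each of a and z.
  thinCodes₅ : Fin n → Fin n → Fin n → Fin n → Fin n → List (Vec (Fin n) 6)
  thinCodes₅ x c y b a = map (λ z → x ∷ a ∷ y ∷ b ∷ z ∷ c ∷ []) (thinCommon b c)

  thinCodes₄ : Fin n → Fin n → Fin n → Fin n → List (Vec (Fin n) 6)
  thinCodes₄ x c y b = concatMap (thinCodes₅ x c y b) (thinCommon x y)

  thinCodes₃ : Fin n → Fin n → Fin n → List (Vec (Fin n) 6)
  thinCodes₃ x c y = concatMap (thinCodes₄ x c y) (select (secondStar? x y))

  thinCodes₂ : Fin n → Fin n → List (Vec (Fin n) 6)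
  thinCodes₂ x c = concatMap (thinCodes₃ x c) (allFin n)

  thinCodes₁ : Fin n → List (Vec (Fin n) 6)
  thinCodes₁ x = concatMap (thinCodes₂ x) (select (x ~?_))

  thinCodes : List (Vec (Fin n) 6)
  thinCodes = concatMap thinCodes₁ (allFin n)

  -- The degree sum counts the edges xc, `size-secondStar` bounds the edges yb, and 64 = 8 · 8
  -- bounds the choices of a and z.
  length-thinCodes : length thinCodes ≤ ∑ (allFin n) degree * (n * 162 * 64)
  length-thinCodes = begin
    length thinCodes                                        ≡⟨ length-concatMap thinCodes₁ (allFin n) ⟩
    ∑ (allFin n) (length ∘ thinCodes₁)                      ≤⟨ ∑-mono (allFin n) (λ {x} _ →
                                                                 length-concatMap-≤ (thinCodes₂ x) (select (x ~?_)) (λ {c} _ → codes₂ x c)) ⟩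
    ∑ (allFin n) (λ x → degree x * (n * 162 * 64))          ≡⟨ sym (*-distribʳ-∑ (n * 162 * 64) (allFin n) degree) ⟩
    ∑ (allFin n) degree * (n * 162 * 64)                    ∎
    where
    open ℕ.≤-Reasoning
    codes₅ : ∀ x c y b a → length (thinCodes₅ x c y b a) ≤ 8
    codes₅ x c y b a = ≤-trans (≤-reflexive (length-map _ (thinCommon b c))) (length-thinCommon b c)
    codes₄ : ∀ x c y b → length (thinCodes₄ x c y b) ≤ 64
    codes₄ x c y b = ≤-trans (length-concatMap-≤ (thinCodes₅ x c y b) (thinCommon x y) (λ {a} _ → codes₅ x c y b a))
      (ℕ.*-monoˡ-≤ 8 (length-thinCommon x y))
    codes₂ : ∀ x c → length (thinCodes₂ x c) ≤ n * 162 * 64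
    codes₂ x c = begin
      length (thinCodes₂ x c)                                       ≡⟨ length-concatMap (thinCodes₃ x c) (allFin n) ⟩
      ∑ (allFin n) (length ∘ thinCodes₃ x c)                        ≤⟨ ∑-mono (allFin n) (λ {y} _ →
                                                                         length-concatMap-≤ (thinCodes₄ x c y) (select (secondStar? x y))
                                                                         (λ {b} _ → codes₄ x c y b)) ⟩
      ∑ (allFin n) (λ y → #[ secondStar? x y ] * 64)                ≡⟨ sym (*-distribʳ-∑ 64 (allFin n) (λ y → #[ secondStar? x y ])) ⟩
      size (secondStar? x) * 64                                     ≤⟨ ℕ.*-monoˡ-≤ 64 (size-secondStar x) ⟩
      n * 162 * 64                                                  ∎

  ∈-thinCodes : ∀ {x a y b z c} → Hexagon x a y b z c → ¬ Fat x y → ¬ Fat b c →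
    (x ∷ a ∷ y ∷ b ∷ z ∷ c ∷ []) ∈ₗ thinCodes
  ∈-thinCodes {x} {a} {y} {b} {z} {c} (hexagon ((_ ∷ x≢y ∷ _) ∷ _) x~a a~y y~b b~z z~c c~x) thin thin′ =
    ∈-concatMap {f = thinCodes₁} (∈-allFin x)
    (∈-concatMap {f = thinCodes₂ x} (∈-select⁺ (x ~?_) (~-sym c~x))
    (∈-concatMap {f = thinCodes₃ x c} (∈-allFin y)
    (∈-concatMap {f = thinCodes₄ x c y} (∈-select⁺ (secondStar? x y) (((x≢y ∘ sym) , a , x~a , a~y) , y~b))
    (∈-concatMap {f = thinCodes₅ x c y b} (∈-thinCommon thin x~a (~-sym a~y))
    (∈-map⁺ (λ v → x ∷ a ∷ y ∷ b ∷ v ∷ c ∷ []) (∈-thinCommon thin′ b~z (~-sym z~c)))))))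

  -- Relabellings, and the dichotomy between thin and fat cycles.

  rotateCode : ∀ {H x a y b z c} → Code H (x ∷ a ∷ y ∷ b ∷ z ∷ c ∷ []) → Code H (a ∷ y ∷ b ∷ z ∷ c ∷ x ∷ [])
  rotateCode {H} (sub , iso) = sub , rotate {H = H} iso

  reflectCode : ∀ {H x a y b z c} → Code H (x ∷ a ∷ y ∷ b ∷ z ∷ c ∷ []) → Code H (z ∷ b ∷ y ∷ a ∷ x ∷ c ∷ [])
  reflectCode {H} (sub , iso) = sub , reflect {H = H} iso

  code⇒hexagon : ∀ {H x a y b z c} → Code H (x ∷ a ∷ y ∷ b ∷ z ∷ c ∷ []) → Hexagon x a y b z c
  code⇒hexagon {H} (sub , iso) = isIso⇒Hexagon {H} sub iso

  FatCode : PreSubgraph n → Fin n → Fin n → Fin n → Fin n → Fin n → Fin n → Set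
  FatCode H x a y b z c = Code H (x ∷ a ∷ y ∷ b ∷ z ∷ c ∷ []) × Fat x y × Fat y z × Fat z x

  -- Unless two opposite vertices are both midpoints of thin pairs, every two opposite vertices
  -- include a midpoint of a fat pair. Such midpoints are never adjacent, so one choice from each
  -- opposite pair yields three alternate vertices.
  classify : ∀ {H x a y b z c} → Code H (x ∷ a ∷ y ∷ b ∷ z ∷ c ∷ []) →
    (∃ λ t → t ∈ₗ thinCodes × Code H t) ⊎
    (∃ λ x → ∃ λ a → ∃ λ y → ∃ λ b → ∃ λ z → ∃ λ c → FatCode H x a y b z c)
  classify {H} {x} {a} {y} {b} {z} {c} k₀
    = go (fat? x y) (fat? y z) (fat? z x) (fat? a b) (fat? b c) (fat? c a)
    where
    k₁ = rotateCode {H} k₀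
    k₂ = rotateCode {H} k₁
    k₃ = rotateCode {H} k₂
    k₄ = rotateCode {H} k₃
    h₀ = code⇒hexagon {H} k₀
    h₁ = code⇒hexagon {H} k₁
    h₂ = code⇒hexagon {H} k₂
    h₃ = code⇒hexagon {H} k₃
    h₄ = code⇒hexagon {H} k₄
    not-adjacent = adjacent-midpoints-not-fat
    go : Dec (Fat x y) → Dec (Fat y z) → Dec (Fat z x) → Dec (Fat a b) → Dec (Fat b c) → Dec (Fat c a) →
      (∃ λ t → t ∈ₗ thinCodes × Code H t) ⊎
      (∃ λ x → ∃ λ a → ∃ λ y → ∃ λ b → ∃ λ z → ∃ λ c → FatCode H x a y b z c)
    -- The first three clauses treat the opposite midpoints a and z, c and y, b and x.
    go (no ¬xy) _        _        _        (no ¬bc) _        = inj₁ (_ , ∈-thinCodes h₀ ¬xy ¬bc , k₀)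
    go _        _        (no ¬zx) (no ¬ab) _        _        = inj₁ (_ , ∈-thinCodes h₁ ¬ab ¬zx , k₁)
    go _        (no ¬yz) _        _        _        (no ¬ca) = inj₁ (_ , ∈-thinCodes h₂ ¬yz ¬ca , k₂)
    go (yes xy) (yes yz) (yes zx) _        _        _        = inj₂ (_ , _ , _ , _ , _ , _ , k₀ , xy , yz , zx)
    go _        _        _        (yes ab) (yes bc) (yes ca) = inj₂ (_ , _ , _ , _ , _ , _ , k₁ , ab , bc , ca)
    go _        _        (yes zx) _        (yes bc) _        = contradiction zx (not-adjacent h₀ bc)
    go _        _        (yes zx) _        _        (yes ca) = contradiction ca (not-adjacent h₁ zx)
    go (yes xy) _        _        _        _        (yes ca) = contradiction xy (not-adjacent h₂ ca)
    go (yes xy) _        _        (yes ab) _        _        = contradiction ab (not-adjacent h₃ xy)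
    go _        (yes yz) _        (yes ab) _        _        = contradiction yz (not-adjacent h₄ ab)

  -- Cycles through fat triangles, and huge codegrees.

  module _ (q : ℕ) where

    -- Codegree at least (1 - ε)n for ε = 1/(q + 1), with denominators cleared.
    Huge : Fin n → Fin n → Set
    Huge x z = suc q * n ≤ suc q * codegree x z + n

    huge? : ∀ x z → Dec (Huge x z)
    huge? x z = suc q * n ℕ.≤? suc q * codegree x z + n

    huge-sym : ∀ {x z} → Huge x z → Huge z x
    huge-sym {x} {z} = subst (λ d → suc q * n ≤ suc q * d + n) (codegree-comm x z)

    -- Among the labellings of a triangle in which {x, z} is not huge, a
    -- unique one has y as small as possible and x < z.
    Canonical : Fin n → Fin n → Fin n → Set
    Canonical x y z = x Fin.< z × ¬ Huge x z × (¬ Huge y z → y Fin.< x) × (¬ Huge x y → y Fin.< z)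

    Configuration : Fin n → Fin n → Fin n → Fin n → Fin n → Set
    Configuration a b x y z = Span a b x y z × Canonical x y z

    configuration? : ∀ a b x y z → Dec (Configuration a b x y z)
    configuration? a b x y z = span? a b x y z
      ×-dec (x Fin.<? z) ×-dec ¬? (huge? x z)
      ×-dec (¬? (huge? y z) →-dec (y Fin.<? x)) ×-dec (¬? (huge? x y) →-dec (y Fin.<? z))

    -- By `span-⊆` one triple is a permutation of the other; canonicity excludes the five nontrivial
    -- permutations, and distinctness excludes repetitions.
    configuration-unique : ∀ {a b x y z x′ y′ z′} → Configuration a b x y z → Configuration a b x′ y′ z′ →
      x ≡ x′ × y ≡ y′ × z ≡ z′
    configuration-unique {x = x} {y} {z} {x′} {y′} {z′} (s@((x≢y , y≢z , x≢z , _) , _) , k) (s′ , k′) =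
      let x∈ , y∈ , z∈ = span-⊆ s′ s in go x∈ y∈ z∈ x≢y y≢z x≢z k k′
      where
      others = x′ ∷ y′ ∷ z′ ∷ []
      go : ∀ {x y z} → x ∈ₗ others → y ∈ₗ others → z ∈ₗ others → x ≢ y → y ≢ z → x ≢ z →
        Canonical x y z → Canonical x′ y′ z′ → x ≡ x′ × y ≡ y′ × z ≡ z′
      go 1st 2nd 3rd _ _ _ _ _ = refl , refl , refl
      go 1st 3rd 2nd _ _ _ (_ , nxz , _ , f) (_ , nxz′ , _ , f′) = contradiction (f nxz′) (Fin.<-asym (f′ nxz))
      go 2nd 1st 3rd _ _ _ (_ , nxz , e , _) (_ , nxz′ , e′ , _) = contradiction (e nxz′) (Fin.<-asym (e′ nxz))
      go 2nd 3rd 1st _ _ _ (_ , nxz , e , _) (_ , nxz′ , _ , f′) =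
        contradiction (e (nxz′ ∘ huge-sym)) (Fin.<-asym (f′ (nxz ∘ huge-sym)))
      go 3rd 1st 2nd _ _ _ (_ , nxz , _ , f) (_ , nxz′ , e′ , _) =
        contradiction (f (nxz′ ∘ huge-sym)) (Fin.<-asym (e′ (nxz ∘ huge-sym)))
      go 3rd 2nd 1st _ _ _ (x<z , _) (x<z′ , _) = contradiction x<z (Fin.<-asym x<z′)
      go 1st 1st _ x≢y _ _ _ _ = contradiction refl x≢y
      go 2nd 2nd _ x≢y _ _ _ _ = contradiction refl x≢y
      go 3rd 3rd _ x≢y _ _ _ _ = contradiction refl x≢y
      go 1st _ 1st _ _ x≢z _ _ = contradiction refl x≢z
      go 2nd _ 2nd _ _ x≢z _ _ = contradiction refl x≢z
      go 3rd _ 3rd _ _ x≢z _ _ = contradiction refl x≢z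
      go _ 1st 1st _ y≢z _ _ _ = contradiction refl y≢z
      go _ 2nd 2nd _ y≢z _ _ _ = contradiction refl y≢z
      go _ 3rd 3rd _ y≢z _ _ _ = contradiction refl y≢z

    -- The search returns some configuration, which `configuration-unique` makes the only one; only
    -- c is then left to choose.
    fatCodes₂ : Fin n → Fin n → List (Vec (Fin n) 6)
    fatCodes₂ a b with any? (λ x → any? λ y → any? λ z → configuration? a b x y z)
    ... | yes (x , y , z , _) = map (λ c → x ∷ a ∷ y ∷ b ∷ z ∷ c ∷ []) (select (common? x z))
    ... | no _                = []

    fatCodes₁ : Fin n → List (Vec (Fin n) 6)
    fatCodes₁ a = concatMap (fatCodes₂ a) (allFin n)

    fatCodes : List (Vec (Fin n) 6)
    fatCodes = concatMap fatCodes₁ (allFin n)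

    -- Since {x, z} is not huge, each pair (a, b) falls short of `suc q * n` by at least n. Over the
    -- n² pairs these deficits add up to n³.
    length-fatCodes : suc q * length fatCodes + n * (n * n) ≤ n * (n * (suc q * n))
    length-fatCodes = over {f = fatCodes₁} λ a → over {f = fatCodes₂ a} (codes₂ a)
      where
      over : {f : Fin n → List (Vec (Fin n) 6)} {c d : ℕ} → (∀ x → suc q * length (f x) + c ≤ d) →
        suc q * length (concatMap f (allFin n)) + n * c ≤ n * d
      over {f} {c} {d} le = subst (λ m → suc q * length (concatMap f (allFin n)) + m * c ≤ m * d) (length-allFin n)
        (length-concatMap-deficit f (allFin n) {suc q} le)
      codes₂ : ∀ a b → suc q * length (fatCodes₂ a b) + n ≤ suc q * n
      codes₂ a b with any? (λ x → any? λ y → any? λ z → configuration? a b x y z)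
      ... | yes (x , y , z , _ , _ , not-huge , _) = subst (λ m → suc q * m + n ≤ suc q * n)
        (sym (length-map _ (select (common? x z)))) (ℕ.<⇒≤ (ℕ.≰⇒> not-huge))
      ... | no _ = subst (λ m → m + n ≤ suc q * n) (sym (*-zeroʳ (suc q))) (ℕ.m≤m+n n (q * n))

    ∈-fatCodes : ∀ {a b x y z c} → Configuration a b x y z → x ~ c → z ~ c →
      (x ∷ a ∷ y ∷ b ∷ z ∷ c ∷ []) ∈ₗ fatCodes
    ∈-fatCodes {a} {b} {x} {y} {z} {c} k x~c z~c =
      ∈-concatMap {f = fatCodes₁} (∈-allFin a) (∈-concatMap {f = fatCodes₂ a} (∈-allFin b) member)
      where
      member : (x ∷ a ∷ y ∷ b ∷ z ∷ c ∷ []) ∈ₗ fatCodes₂ a b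
      member with any? (λ x → any? λ y → any? λ z → configuration? a b x y z)
      ... | no none = contradiction (x , y , z , k) none
      ... | yes (x′ , y′ , z′ , k′) with configuration-unique k k′
      ... | refl , refl , refl = ∈-map⁺ (λ v → x ∷ a ∷ y ∷ b ∷ z ∷ v ∷ []) (∈-select⁺ (common? x z) (x~c , z~c))

    Coded : PreSubgraph n → Set
    Coded H = ∃ λ t → t ∈ₗ fatCodes × Code H t

    rotateFat : ∀ {H x a y b z c} → FatCode H x a y b z c → FatCode H y b z c x a
    rotateFat {H} (k , xy , yz , zx) = rotateCode {H} (rotateCode {H} k) , yz , zx , xy

    reflectFat : ∀ {H x a y b z c} → FatCode H x a y b z c → FatCode H z b y a x c
    reflectFat {H} (k , xy , yz , zx) = reflectCode {H} k , fat-sym yz , fat-sym xy , fat-sym zx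

    fat⇒≢ : ∀ {H x a y b z c} → FatCode H x a y b z c → x ≢ y × y ≢ z × x ≢ z
    fat⇒≢ {H} (k , _) with code⇒hexagon {H} k
    ... | hexagon ((_ ∷ xy ∷ _ ∷ xz ∷ _) ∷ _ ∷ (_ ∷ yz ∷ _) ∷ _) _ _ _ _ _ _ = xy , yz , xz

    canonical⇒coded : ∀ {H x a y b z c} → FatCode H x a y b z c → Canonical x y z → Coded H
    canonical⇒coded {H} (k , xy , yz , zx) canonical with code⇒hexagon {H} k
    ... | hexagon ((xa ∷ x≢y ∷ xb ∷ x≢z ∷ _) ∷ (_ ∷ ab ∷ az ∷ _) ∷ (_ ∷ y≢z ∷ _) ∷ _) x~a a~y y~b b~z z~c c~x =
      _ , ∈-fatCodes
        (((x≢y , y≢z , x≢z , ab , az , xb ∘ sym) , (~-sym x~a , a~y , ~-sym y~b , b~z) , xy , yz , fat-sym zx) , canonical)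
        (~-sym c~x) z~c , k

    -- Only x < z is missing from canonicity. Reflecting the cycle exchanges x and z, and with them
    -- the last two conditions.
    minimal⇒coded : ∀ {H x a y b z c} → FatCode H x a y b z c →
      ¬ Huge x z → (¬ Huge y z → y Fin.< x) → (¬ Huge x y → y Fin.< z) → Coded H
    minimal⇒coded {H} {x} {z = z} k nxz y<x y<z with Fin.<-cmp x z
    ... | tri< x<z _ _ = canonical⇒coded {H} k (x<z , nxz , y<x , y<z)
    ... | tri≈ _ x≡z _ = contradiction x≡z (proj₂ (proj₂ (fat⇒≢ {H} k)))
    ... | tri> _ _ z<x = canonical⇒coded {H} (reflectFat {H} k)
      (z<x , nxz ∘ huge-sym , (λ nyx → y<z (nyx ∘ huge-sym)) , (λ nzy → y<x (nzy ∘ huge-sym)))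

    -- z takes the place of y if it is a better candidate.
    half-minimal⇒coded : ∀ {H x a y b z c} → FatCode H x a y b z c →
      ¬ Huge x z → (¬ Huge y z → y Fin.< x) → Coded H
    half-minimal⇒coded {H} {x} {y = y} {z = z} k nxz y<x with huge? x y | Fin.<-cmp y z
    ... | yes hxy | _            = minimal⇒coded {H} k nxz y<x (λ nxy → contradiction hxy nxy)
    ... | no _    | tri< y<z _ _ = minimal⇒coded {H} k nxz y<x (λ _ → y<z)
    ... | no _    | tri≈ _ y≡z _ = contradiction y≡z (proj₁ (proj₂ (fat⇒≢ {H} k)))
    ... | no nxy  | tri> _ _ z<y = minimal⇒coded {H} (rotateFat {H} k) (nxy ∘ huge-sym)
      (λ nzx → z<y) (λ nyz → Fin.<-trans z<y (y<x nyz))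

    not-huge⇒coded : ∀ {H x a y b z c} → FatCode H x a y b z c → ¬ Huge x z → Coded H
    not-huge⇒coded {H} {x} {y = y} {z = z} k nxz with huge? y z | Fin.<-cmp y x
    ... | yes hyz | _            = half-minimal⇒coded {H} k nxz (λ nyz → contradiction hyz nyz)
    ... | no _    | tri< y<x _ _ = half-minimal⇒coded {H} k nxz (λ _ → y<x)
    ... | no _    | tri≈ _ y≡x _ = contradiction (sym y≡x) (proj₁ (fat⇒≢ {H} k))
    -- Here x becomes the middle vertex: the relabelled triangle is y, x, z.
    ... | no nyz  | tri> _ _ x<y = half-minimal⇒coded {H} (reflectFat {H} (rotateFat {H} (rotateFat {H} k))) nyz (λ _ → x<y)

    module _ (no-huge : ∀ {x y z} → x ≢ y → x ≢ z → y ≢ z → Huge x y → ¬ Huge y z) where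

      -- By `no-huge` one of {x, y} and {y, z} is not huge, and a rotation makes it the pair of
      -- first and third vertices.
      fat⇒coded : ∀ {H x a y b z c} → FatCode H x a y b z c → Coded H
      fat⇒coded {H} {x} {y = y} {z = z} k with huge? x y | huge? y z
      ... | no ¬xy | _      = not-huge⇒coded {H} (rotateFat {H} k) (¬xy ∘ huge-sym)
      ... | _      | no ¬yz = not-huge⇒coded {H} (rotateFat {H} (rotateFat {H} k)) (¬yz ∘ huge-sym)
      ... | yes xy | yes yz = let x≢y , y≢z , x≢z = fat⇒≢ {H} k in contradiction yz (no-huge x≢y x≢z y≢z xy)

      -- Each cycle is coded by one of its labellings, and `isIso-unique` says that no labelling
      -- serves two cycles.
      #copies-≤ : #copies (Cycle 6) G ≤ length thinCodes + length fatCodes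
      #copies-≤ = ≤-trans
        (length-encode-≤ Code (Unique.filter⁺ (isCopy? (Cycle 6) G) (preSubgraphs-unique n))
          (λ {H} H∈ → encode {H} (proj₂ (∈-filter⁻ (isCopy? (Cycle 6) G) {xs = preSubgraphs n} H∈)))
          (λ {H} {H′} (sub , iso) (sub′ , iso′) → isIso-unique (Cycle 6) G {H} {H′} sub iso sub′ iso′))
        (≤-reflexive (length-++ thinCodes))
        where
        encode : ∀ {H} → IsCopy (Cycle 6) G H → ∃ λ t → t ∈ₗ thinCodes ++ fatCodes × Code H t
        encode {H} (sub , f , iso) =
          [ (λ (t , t∈ , k) → t , ∈-++⁺ˡ t∈ , k)
          , (λ (_ , _ , _ , _ , _ , _ , k) → let t , t∈ , k′ = fat⇒coded {H} k in t , ∈-++⁺ʳ thinCodes t∈ , k′)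
          ]′ (classify {H} (sub , isIso-resp-≗ (Cycle 6) H listed iso))
          where
          listed : ∀ i → f i ≡ lookup (f 0F ∷ f 1F ∷ f 2F ∷ f 3F ∷ f 4F ∷ f 5F ∷ []) i
          listed = λ { 0F → refl ; 1F → refl ; 2F → refl ; 3F → refl ; 4F → refl ; 5F → refl }

      -- The constant 162 · 64 comes from `length-thinCodes` and 49 from the bound on the degree
      -- sum.
      n-bounded : 5 ≤ n → R n ≤ #copies (Cycle 6) G → n ≤ threshold (suc q) (162 * 64) 49
      n-bounded 5≤n many = n≤threshold n (suc q) (162 * 64) 49
        {T = length thinCodes} {F = length fatCodes} {D = ∑ (allFin n) degree}
        (≤-trans (s≤s z≤n) 5≤n)
        (≤-trans (n³-≤-R 5≤n) (ℕ.+-monoˡ-≤ (12 * (n * n)) (≤-trans many #copies-≤)))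
        (≤-trans length-thinCodes (≤-reflexive (cong (λ m → ∑ (allFin n) degree * m) (ℕ.*-assoc n 162 64))))
        *-∑-degree-≤
        length-fatCodes

  -- The triple with a large common neighbourhood.

  module _ (d : ℕ) where

    CommonTriple : Fin n → Fin n → Fin n → Set
    CommonTriple a b c = a ≢ b × a ≢ c × b ≢ c × suc d * n ≤ suc d * ∣ N G a ∩ N G b ∩ N G c ∣ + n

    commonTriple? : ∀ a b c → Dec (CommonTriple a b c)
    commonTriple? a b c = ¬? (a Fin.≟ b) ×-dec ¬? (a Fin.≟ c) ×-dec ¬? (b Fin.≟ c)
      ×-dec (suc d * n ℕ.≤? suc d * ∣ N G a ∩ N G b ∩ N G c ∣ + n)

    -- Here ε = 1/(2(d + 1)). By inclusion-exclusion the two common neighbourhoods, each missing at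
    -- most εn vertices, meet in at least (1 - 2ε)n.
    huge⇒common : ∀ {x y z} → Huge (d + suc d) x y → Huge (d + suc d) y z →
      suc d * n ≤ suc d * ∣ N G x ∩ N G y ∩ N G z ∣ + n
    huge⇒common {x} {y} {z} xy yz = ℕ.*-cancelˡ-≤ 2 (ℕ.+-cancelˡ-≤ ((q + q) * n) _ _ (begin
      (q + q) * n + 2 * (q * n)                                      ≡⟨ regroup₁ q n ⟩
      (q + q) * n + (q + q) * n                                      ≤⟨ +-mono-≤ xy yz ⟩
      (q + q) * codegree x y + n + ((q + q) * codegree y z + n)      ≡⟨ regroup₂ q n (codegree x y) (codegree y z) ⟩
      (q + q) * (codegree x y + codegree y z) + (n + n)              ≤⟨ ℕ.+-monoˡ-≤ (n + n) (ℕ.*-monoʳ-≤ (q + q) codegrees) ⟩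
      (q + q) * (n + m) + (n + n)                                    ≡⟨ regroup₃ q n m ⟩
      (q + q) * n + 2 * (q * m + n)                                  ∎))
      where
      open ℕ.≤-Reasoning
      q m : ℕ
      q = suc d
      m = ∣ N G x ∩ N G y ∩ N G z ∣
      codegrees : codegree x y + codegree y z ≤ n + m
      codegrees = ≤-trans (#-inclusion-exclusion (common? x y) (common? y z))
        (ℕ.+-monoʳ-≤ n (#-≤-∣∣ _ (N G x ∩ N G y ∩ N G z)
          (λ ((x~v , y~v) , (_ , z~v)) → x∈p∩q⁺ (x~v , x∈p∩q⁺ (y~v , z~v)))))
      regroup₁ : ∀ q n → (q + q) * n + 2 * (q * n) ≡ (q + q) * n + (q + q) * n
      regroup₁ = solve-∀
      regroup₂ : ∀ q n a b → (q + q) * a + n + ((q + q) * b + n) ≡ (q + q) * (a + b) + (n + n)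
      regroup₂ = solve-∀
      regroup₃ : ∀ q n m → (q + q) * (n + m) + (n + n) ≡ (q + q) * n + 2 * (q * m + n)
      regroup₃ = solve-∀

    -- Without such a triple, no two huge pairs on three distinct vertices share a vertex, and
    -- `n-bounded` contradicts the size of n. A finite search decides existence, which justifies the
    -- indirect argument.
    commonTriple : 5 + threshold (suc d + suc d) (162 * 64) 49 < n → R n ≤ #copies (Cycle 6) G →
      ∃ λ a → ∃ λ b → ∃ λ c → CommonTriple a b c
    commonTriple large many =
      decidable-stable (any? (λ a → any? λ b → any? λ c → commonTriple? a b c)) λ none →
        ℕ.<⇒≱ (ℕ.≤-<-trans (ℕ.m≤n+m _ 5) large)
          (n-bounded (d + suc d)
            (λ x≢y x≢z y≢z xy yz → none (_ , _ , _ , x≢y , x≢z , y≢z , huge⇒common xy yz))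
            (≤-trans (ℕ.m≤m+n 5 _) (ℕ.<⇒≤ large)) many)

lemma2p11 : ∀ (δ : ℚ) → 0ℚ ℚ.< δ →
    ∃[ ρ ] 0ℚ ℚ.< ρ ×
    (∃[ n₀ ] ∀ (n : ℕ) → n ≥ n₀ →
    ∀ (G : Graph n) →
    Free (Cycle 8) G →
    #copies (Cycle 6) G ≥ R n →
    ∃[ a ] ∃[ b ] ∃[ c ]
    a ≢ b × a ≢ c × b ≢ c ×
    + ∣ N G a ∩ N G b ∩ N G c ∣ / 1 ℚ.≥ (1ℚ ℚ.- δ) ℚ.* (+ n / 1))
lemma2p11 δ@(mkℚ _ d _) 0<δ =
  -- The denominator of δ is `suc d`, and the triple is found with 1/(d + 1) ≤ δ in place of δ.
  1ℚ , ℚ.positive⁻¹ 1ℚ , suc (5 + threshold (suc d + suc d) (162 * 64) 49) , λ n large G free many →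
    let a , b , c , a≢b , a≢c , b≢c , common = OctagonFree.commonTriple G free d large many
    in a , b , c , a≢b , a≢c , b≢c , proportion δ 0<δ common
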